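{- Let $\alpha$ be a fixed partition with $\alpha/\tilde\alpha\vdash 2k$, where $\tilde\alpha$ is the 2-core of $\alpha$, and let $n\ge0$. Then $$W_n^\alpha=\sum_{j=0}^k\binom{n}{j}W_{ -j}^\alpha\sum_{\pi\in CI_{n-j}}{\rm wt}(\pi).$$
   Context: Partitions are identified with Young diagrams (cell $(i,j)$: row $i$, column $j$); for $\mu\subseteq\lambda$, $\lambda/\mu$ is the set of cells of $\lambda$ not in $\mu$, $\lambda/\mu\vdash n$ means it has $n$ cells; $v(\lambda/\mu)$, $h(\lambda/\mu)$ are its numbers of cells in even rows, resp. even columns. The 2-core $\tilde\alpha$ is obtained by repeatedly removing a domino (two adjacent cells) leaving a partition until impossible. An SDT of shape $\lambda/\mu\vdash 2n$ is a bijection from the cells to $[2n]$ increasing along rows and columns such that entries $2i-1,2i$ form a domino for each $i$; for an SDT $D$, $sp(D)$ is half its number of vertical dominoes; $f_2^{\lambda/\mu}(q)=\sum_D q^{sp(D)}$ over SDTs of shape $\lambda/\mu$. For $n\ge0$, $W_n^\alpha=\sum_{\lambda:\ \lambda/\alpha\vdash 2n}x^{n-v(\lambda/\alpha)}y^{n-h(\lambda/\alpha)}f_2^{\lambda/\alpha}(q)$ and $W_{ -n}^\alpha=\sum_{\mu:\ \alpha/\mu\vdash2n}x^{ -n+v(\alpha/\mu)}y^{ -n+h(\alpha/\mu)}f_2^{\alpha/\mu}(q)$. A colored permutation of $[n]$ is a permutation with bars on some values; its permutation matrix has $(i,k)$ entry $1$ if $\pi_i=k$, $-1$ if $\pi_i=\bar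 k$, $0$ otherwise; $tc(\pi)$ is the number of barred values. $CI_n$ is the set of colored permutations of $[n]$ with symmetric permutation matrix (colored involutions), $CI_0=\{\emptyset\}$. Such $\pi$ consists of 1-cycles and 2-cycles; $\sigma_1(\pi)$, $\bar\sigma_1(\pi)$ are its numbers of unbarred, resp. barred, 1-cycles, and ${\rm wt}(\pi)=x^{\sigma_1(\pi)}y^{\bar\sigma_1(\pi)}q^{tc(\pi)/2}$ (the empty involution has weight $1$). -}

module Defs where

open import Data.Bool using (Bool; true; false; _∧_; _∨_; not; T; if_then_else_)
open import Data.Nat using (ℕ; zero; suc; _+_; _*_; _∸_; _≡ᵇ_; _<ᵇ_; _≤ᵇ_)
open import Data.Nat.Combinatorics using (_C_)
open import Data.Integer as ℤ using (ℤ; +_)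
open import Data.Fin using (Fin; toℕ)
open import Data.List.Base using (List; []; _∷_; _++_; map; length; upTo; allFin)
open import Data.Bool.ListAction using (all; any)
open import Relation.Nullary using (does)
open import Data.Vec using (Vec; lookup)
open import Data.Product using (Σ; _×_; _,_; proj₁; proj₂)
open import Data.Empty using (⊥)
open import Function.Bundles using (_↔_)
open import Relation.Binary.PropositionalEquality using (_≡_)
open import Relation.Nullary using (¬_)

bfilter : {A : Set} → (A → Bool) → List A → List A
bfilter p [] = []
bfilter p (x ∷ xs) = if p x then x ∷ bfilter p xs else bfilter p xs

count : {A : Set} → (A → Bool) → List A → ℕ
count p xs = length (bfilter p xs)

isEven : ℕ → Bool
isEven zero = true
isEven (suc n) = not (isEven n)

-- Cells and partitions (Young diagrams, 1-indexed: cell (i , j) = row i, column j)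

Cell : Set
Cell = ℕ × ℕ

_=ᶜ_ : Cell → Cell → Bool
(i , j) =ᶜ (i' , j') = (i ≡ᵇ i') ∧ (j ≡ᵇ j')

_∈ᵇ_ : Cell → List Cell → Bool
c ∈ᵇ cs = any (c =ᶜ_) cs

isPartition : List ℕ → Bool
isPartition [] = true
isPartition (a ∷ []) = 1 ≤ᵇ a
isPartition (a ∷ b ∷ rest) = (b ≤ᵇ a) ∧ isPartition (b ∷ rest)

record Partition : Set where
  constructor mkPartition
  field
    parts : List ℕ
    valid : T (isPartition parts)
open Partition public

-- length of row i (1-indexed), 0 beyond the last row
rowLen : List ℕ → ℕ → ℕ
rowLen [] _ = 0
rowLen (r ∷ rs) zero = 0
rowLen (r ∷ rs) (suc zero) = r
rowLen (r ∷ rs) (suc (suc i)) = rowLen rs (suc i)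

range1 : ℕ → List ℕ
range1 r = map suc (upTo r)

cellsFrom : ℕ → List ℕ → List Cell
cellsFrom i [] = []
cellsFrom i (r ∷ rs) = map (λ j → (i , j)) (range1 r) ++ cellsFrom (suc i) rs

cells : Partition → List Cell
cells λ' = cellsFrom 1 (parts λ')

inDiagram : Partition → Cell → Bool
inDiagram λ' (i , j) = (1 ≤ᵇ i) ∧ ((1 ≤ᵇ j) ∧ (j ≤ᵇ rowLen (parts λ') i))

_⊆ᵇ_ : Partition → Partition → Bool
μ ⊆ᵇ λ' = all (inDiagram λ') (cells μ)

skewCells : Partition → Partition → List Cell
skewCells λ' μ = bfilter (λ c → not (inDiagram μ c)) (cells λ')

skewSize : Partition → Partition → ℕ
skewSize λ' μ = length (skewCells λ' μ)

vEven : Partition → Partition → ℕ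
vEven λ' μ = count (λ c → isEven (proj₁ c)) (skewCells λ' μ)

hEven : Partition → Partition → ℕ
hEven λ' μ = count (λ c → isEven (proj₂ c)) (skewCells λ' μ)

adjacent : Cell → Cell → Bool
adjacent (i , j) (i' , j') =
  ((i ≡ᵇ i') ∧ ((suc j ≡ᵇ j') ∨ (suc j' ≡ᵇ j))) ∨
  ((j ≡ᵇ j') ∧ ((suc i ≡ᵇ i') ∨ (suc i' ≡ᵇ i)))

-- Standard domino tableaux.
-- A bijection T from the cells of λ/μ to [2n] is encoded by its inverse,
-- the list  order = [T⁻¹(1), T⁻¹(2), …, T⁻¹(2n)].

distinct : List Cell → Bool
distinct [] = true
distinct (c ∷ cs) = not (c ∈ᵇ cs) ∧ distinct cs

-- d must not lie strictly left of c in the same row, nor strictly above c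
-- in the same column, whenever c has the smaller entry
notBefore : Cell → Cell → Bool
notBefore (i , j) (i' , j') =
  not ((i ≡ᵇ i') ∧ (j' <ᵇ j)) ∧ not ((j ≡ᵇ j') ∧ (i' <ᵇ i))

increasing : List Cell → Bool
increasing [] = true
increasing (c ∷ ds) = all (notBefore c) ds ∧ increasing ds

dominoPairs : List Cell → Bool
dominoPairs [] = true
dominoPairs (c ∷ []) = false
dominoPairs (c ∷ d ∷ rest) = adjacent c d ∧ dominoPairs rest

isSDT : Partition → Partition → List Cell → Bool
isSDT λ' μ order =
  distinct order ∧
  (all (_∈ᵇ skewCells λ' μ) order ∧
  (all (_∈ᵇ order) (skewCells λ' μ) ∧
  (increasing order ∧
   dominoPairs order)))

record SDT (λ' μ : Partition) : Set where
  constructor mkSDT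
  field
    order : List Cell
    valid : T (isSDT λ' μ order)
open SDT public

-- number of vertical dominoes (= 2 sp(D))
vertDominoes : List Cell → ℕ
vertDominoes [] = 0
vertDominoes (c ∷ []) = 0
vertDominoes ((i , j) ∷ (i' , j') ∷ rest) =
  (if j ≡ᵇ j' then 1 else 0) + vertDominoes rest

-- Monomials x^a y^b q^(c/2), encoded as (a , b , c) : ℤ × ℤ × ℕ
-- (the third component is the exponent of q^(1/2)).

Mono : Set
Mono = ℤ × ℤ × ℕ

_·_ : Mono → Mono → Mono
(a , b , c) · (a' , b' , c') = (a ℤ.+ a' , b ℤ.+ b' , c + c')

-- A weighted finite set; its generating function is Σ_{o ∈ Obj} wt(o).
record WSet : Set₁ where
  field
    Obj : Set
    wt  : Obj → Mono
open WSet public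

-- Equality of generating functions (coefficients are counts):
-- for every monomial, the objects of that weight are in bijection.
_≋_ : WSet → WSet → Set
A ≋ B = (m : Mono) → (Σ (Obj A) λ o → wt A o ≡ m) ↔ (Σ (Obj B) λ o → wt B o ≡ m)

_⊗_ : WSet → WSet → WSet
A ⊗ B = record { Obj = Obj A × Obj B ; wt = λ p → wt A (proj₁ p) · wt B (proj₂ p) }

scale : ℕ → WSet → WSet
scale c A = record { Obj = Fin c × Obj A ; wt = λ p → wt A (proj₂ p) }

sumTo : (k : ℕ) → (ℕ → WSet) → WSet
sumTo k F = record
  { Obj = Σ (Fin (suc k)) (λ j → Obj (F (toℕ j)))
  ; wt  = λ p → wt (F (toℕ (proj₁ p))) (proj₂ p) }

W⁺ : Partition → ℕ → WSet
W⁺ α n = record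
  { Obj = Σ Partition (λ λ' → T (α ⊆ᵇ λ') × (skewSize λ' α ≡ 2 * n) × SDT λ' α)
  ; wt  = λ { (λ' , _ , _ , D) →
      ( (+ n) ℤ.- (+ vEven λ' α)
      , (+ n) ℤ.- (+ hEven λ' α)
      , vertDominoes (order D) ) } }

W⁻ : Partition → ℕ → WSet
W⁻ α n = record
  { Obj = Σ Partition (λ μ → T (μ ⊆ᵇ α) × (skewSize α μ ≡ 2 * n) × SDT α μ)
  ; wt  = λ { (μ , _ , _ , D) →
      ( ℤ.- (+ n) ℤ.+ (+ vEven α μ)
      , ℤ.- (+ n) ℤ.+ (+ hEven α μ)
      , vertDominoes (order D) ) } }

-- Colored involutions.
-- A colored permutation of [n] is encoded as π : Vec (Fin n × Bool) n,
-- π_i = (k , b) meaning π_i = k (b = false) or π_i = k̄ (b = true).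

finList : (n : ℕ) → List (Fin n)
finList n = allFin n

_==ᶠ_ : {n : ℕ} → Fin n → Fin n → Bool
a ==ᶠ b = toℕ a ≡ᵇ toℕ b

_==ᵇ_ : Bool → Bool → Bool
true ==ᵇ b = b
false ==ᵇ b = not b

isPerm : {n : ℕ} → Vec (Fin n × Bool) n → Bool
isPerm {n} π = all (λ i → all (λ j →
    (i ==ᶠ j) ∨ not (proj₁ (lookup π i) ==ᶠ proj₁ (lookup π j)))
  (finList n)) (finList n)

entry : {n : ℕ} → Vec (Fin n × Bool) n → Fin n → Fin n → ℤ
entry π i k with lookup π i
... | (k' , b) = if k' ==ᶠ k then (if b then ℤ.- (+ 1) else + 1) else + 0

_==ᶻ_ : ℤ → ℤ → Bool
a ==ᶻ b = does (a ℤ.≟ b)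

isSymmetric : {n : ℕ} → Vec (Fin n × Bool) n → Bool
isSymmetric {n} π = all (λ i → all (λ k → entry π i k ==ᶻ entry π k i)
  (finList n)) (finList n)

record ColInv (n : ℕ) : Set where
  constructor mkColInv
  field
    perm  : Vec (Fin n × Bool) n
    valid : T (isPerm perm ∧ isSymmetric perm)
open ColInv public

σ₁ : {n : ℕ} → ColInv n → ℕ
σ₁ {n} π = count (λ i → (proj₁ (lookup (perm π) i) ==ᶠ i) ∧ not (proj₂ (lookup (perm π) i))) (finList n)

σ̄₁ : {n : ℕ} → ColInv n → ℕ
σ̄₁ {n} π = count (λ i → (proj₁ (lookup (perm π) i) ==ᶠ i) ∧ proj₂ (lookup (perm π) i)) (finList n)

tc : {n : ℕ} → ColInv n → ℕ
tc {n} π = count (λ i → proj₂ (lookup (perm π) i)) (finList n)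

CI : ℕ → WSet
CI n = record
  { Obj = ColInv n
  ; wt  = λ π → (+ σ₁ π , + σ̄₁ π , tc π) }

isDominoRemoval : Partition → Partition → Bool
isDominoRemoval α β with skewCells α β
... | c ∷ d ∷ [] = (β ⊆ᵇ α) ∧ adjacent c d
... | _ = false

data Removals : Partition → Partition → Set where
  done : ∀ {α} → Removals α α
  step : ∀ {α β γ} → T (isDominoRemoval α β) → Removals β γ → Removals α γ

IsTwoCore : Partition → Partition → Set
IsTwoCore α β = Removals α β × ((γ : Partition) → ¬ T (isDominoRemoval β γ))

module Submission where

-- On functions of partitions let (U v)(α) and (D v)(α) be the sums of v(β) over
-- the partitions β obtained from α by adding, resp. removing, a domino, with the
-- weights of W_1 and W_{-1}; then W_n = Uⁿ1 and W_{-j} = Dʲ1 for the constant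
-- function 1. Moving dominoes locally gives U1 = D1 + c and UD = DU + e with
-- c = x + y q^(1/2) and e = 1 + q, hence
--   W_{n+1} = D W_n + c W_n + n e W_{n-1}.
-- The generating functions of colored involutions satisfy
-- t_{n+1} = c t_n + n e t_{n-1} (look at the cycle of the first letter), so by
-- Pascal's rule Σ_j (n choose j) t_{n-j} W_{-j} obeys the same recurrence.
-- The terms with j > k vanish: distinct domino removals commute, so no chain of
-- removals from α is longer than one that reaches the 2-core. No step cancels
-- anything, so every identity is a weight-preserving bijection.

open import Defs
open import Data.Bool using (Bool; true; false; _∧_; _∨_; not; T; if_then_else_)
open import Data.Bool.Properties using (T-irrelevant; T-≡; T-∧; T-∨; T?)
open import Data.Bool.ListAction using (all)
open import Data.Empty using (⊥; ⊥-elim)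
open import Data.Fin as Fin using (Fin; toℕ; fromℕ<; punchIn; punchOut)
open import Data.Fin.Properties using (+↔⊎; *↔×; toℕ-injective; toℕ-fromℕ<; punchIn-punchOut; punchInᵢ≢i; punchIn-injective)
open import Data.Integer as ℤ using (ℤ; +_)
import Data.Integer.Properties as ℤₚ
import Data.Integer.Tactic.RingSolver as ℤ-Solver
open import Data.List.Base as List using (List; []; _∷_; map; length)
open import Data.List.Membership.Propositional using (_∈_)
open import Data.List.Membership.Propositional.Properties using (∈-map⁺; ∈-map⁻; ∈-++⁺ˡ; ∈-++⁺ʳ; ∈-++⁻; ∈-upTo⁺; ∈-upTo⁻; ∈-allFin)
open import Data.List.Membership.Propositional.Properties.WithK using (unique∧set⇒bag)
open import Data.List.Properties using (∷-injective)
open import Data.List.Relation.Binary.BagAndSetEquality using (∼bag⇒↭)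
open import Data.List.Relation.Binary.Permutation.Propositional using (_↭_; prep; swap) renaming (refl to ↭-refl; trans to ↭-trans)
open import Data.List.Relation.Binary.Permutation.Propositional.Properties using (↭-length)
open import Data.List.Relation.Unary.All as All using (All; []; _∷_)
import Data.List.Relation.Unary.All.Properties as Allₚ
import Data.List.Relation.Unary.Any.Properties as Anyₚ
open import Data.List.Relation.Unary.AllPairs using (AllPairs; []; _∷_)
open import Data.List.Relation.Unary.Unique.Propositional using (Unique)
import Data.List.Relation.Unary.Unique.Propositional.Properties as Uniqueₚ
open import Data.List.Relation.Unary.Any as Any using (here; there)
open import Data.Nat using (ℕ; zero; suc; pred; _+_; _*_; _∸_; _≤_; _<_; z≤n; s≤s; _≡ᵇ_; _<ᵇ_; _≤ᵇ_; _⊔_)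
open import Data.Nat.Combinatorics using (_C_; nCk≡nC[n∸k]; nCk+nC[k+1]≡[n+1]C[k+1]; nCn≡1; k>n⇒nCk≡0)
open import Data.Nat.Properties
import Algebra.Properties.CommutativeSemigroup +-commutativeSemigroup as +-CSProperties
open import Data.Product using (Σ; ∃; _×_; _,_; proj₁; proj₂)
open import Data.Product.Properties using (≡-dec)
open import Data.Sum using (_⊎_; inj₁; inj₂)
open import Data.Unit using (⊤; tt)
open import Data.Vec as Vec using (Vec; lookup; tabulate)
open import Data.Vec.Properties using (lookup∘tabulate; tabulate∘lookup; tabulate-cong)
open import Function.Base using (_∘_; id)
open import Function.Bundles using (_↔_; Inverse; Equivalence; mk⇔; mk↔ₛ′)
open import Relation.Binary.PropositionalEquality using (_≡_; _≢_; refl; sym; trans; cong; cong₂; subst; module ≡-Reasoning)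
open import Relation.Nullary using (¬_; Dec; yes; no; contradiction; recompute; ¬?; _×-dec_; _⊎-dec_; map′)

-- Generating functions of weighted sets

-- The right-hand side of the theorem contains powers of D only, and D turns a term of index j into
-- one of index j + 1, which is one half of Pascal's rule. So W_{n+1} = U W_n has to be rewritten
-- through D W_n; this is what the commutation of U and D is for. As both act on functions, U D at a
-- partition first adds a domino and then removes one, and UD = DU + e is the relation of a weighted
-- differential poset. The constants c and e have one origin. Only the first row and the first
-- column have no preceding line. Their addable dominoes weigh x and y q^(1/2), and added and
-- removed again they weigh 1 and q. These are also the weights of the unbarred and barred 1-cycles,
-- and of the unbarred and barred 2-cycles.

infix 4 _≅_
infixr 6 _⊕_

-- Implies _≋_, but composes without reference to individual monomials.
record _≅_ (A B : WSet) : Set where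
  field
    to      : Obj A → Obj B
    from    : Obj B → Obj A
    to-from : ∀ b → to (from b) ≡ b
    from-to : ∀ a → from (to a) ≡ a
    wt-to   : ∀ a → wt B (to a) ≡ wt A a
open _≅_

≅-refl : ∀ {A} → A ≅ A
≅-refl = record { to = id ; from = id ; to-from = λ _ → refl ; from-to = λ _ → refl ; wt-to = λ _ → refl }

≅-sym : ∀ {A B} → A ≅ B → B ≅ A
≅-sym {A} {B} f = record
  { to = from f ; from = to f ; to-from = from-to f ; from-to = to-from f
  ; wt-to = λ b → trans (sym (wt-to f (from f b))) (cong (wt B) (to-from f b)) }

≅-trans : ∀ {A B C} → A ≅ B → B ≅ C → A ≅ C
≅-trans f g = record
  { to = to g ∘ to f ; from = from f ∘ from g
  ; to-from = λ c → trans (cong (to g) (to-from f (from g c))) (to-from g c)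
  ; from-to = λ a → trans (cong (from f) (from-to g (to f a))) (from-to f a)
  ; wt-to = λ a → trans (wt-to g (to f a)) (wt-to f a) }

module ≅-Reasoning where
  infix  3 _∎
  infixr 2 _≅⟨_⟩_ _≅⟨_⟨_

  _≅⟨_⟩_ : ∀ A {B C} → A ≅ B → B ≅ C → A ≅ C
  A ≅⟨ f ⟩ g = ≅-trans f g

  _≅⟨_⟨_ : ∀ A {B C} → B ≅ A → B ≅ C → A ≅ C
  A ≅⟨ f ⟨ g = ≅-trans (≅-sym f) g

  _∎ : ∀ A → A ≅ A
  A ∎ = ≅-refl

Σ-≡-prop : {A : Set} {P : A → Set} → (∀ {a} (p q : P a) → p ≡ q) →
  {x y : Σ A P} → proj₁ x ≡ proj₁ y → x ≡ y
Σ-≡-prop irr {_ , p} {_ , q} refl = cong (_ ,_) (irr p q)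

uip : {A : Set} {x y : A} (p q : x ≡ y) → p ≡ q
uip refl refl = refl

≅⇒≋ : ∀ {A B} → A ≅ B → A ≋ B
≅⇒≋ f m = mk↔ₛ′
  (λ (a , e) → to f a , trans (wt-to f a) e)
  (λ (b , e) → from f b , trans (wt-to (≅-sym f) b) e)
  (λ (b , _) → Σ-≡-prop uip (to-from f b))
  (λ (a , _) → Σ-≡-prop uip (from-to f a))

_⊕_ : WSet → WSet → WSet
A ⊕ B = record { Obj = Obj A ⊎ Obj B ; wt = λ { (inj₁ a) → wt A a ; (inj₂ b) → wt B b } }

ΣW : (I : Set) → (I → WSet) → WSet
ΣW I F = record { Obj = Σ I (Obj ∘ F) ; wt = λ (i , x) → wt (F i) x }

1ᴹ : Mono
1ᴹ = (+ 0 , + 0 , 0)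

𝟙 : WSet
𝟙 = record { Obj = ⊤ ; wt = λ _ → 1ᴹ }

,-≡³ : {a a' b b' : ℤ} {c c' : ℕ} → a ≡ a' → b ≡ b' → c ≡ c' → _≡_ {A = Mono} (a , b , c) (a' , b' , c')
,-≡³ refl refl refl = refl

·-assoc : ∀ x y z → (x · y) · z ≡ x · (y · z)
·-assoc (a , b , c) (d , e , f) (g , h , i) = ,-≡³ (ℤₚ.+-assoc a d g) (ℤₚ.+-assoc b e h) (+-assoc c f i)

·-comm : ∀ x y → x · y ≡ y · x
·-comm (a , b , c) (d , e , f) = ,-≡³ (ℤₚ.+-comm a d) (ℤₚ.+-comm b e) (+-comm c f)

·-identityˡ : ∀ x → 1ᴹ · x ≡ x
·-identityˡ (a , b , c) = ,-≡³ (ℤₚ.+-identityˡ a) (ℤₚ.+-identityˡ b) refl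

·-identityʳ : ∀ x → x · 1ᴹ ≡ x
·-identityʳ x = trans (·-comm x 1ᴹ) (·-identityˡ x)

·-swapˡ : ∀ x y z → x · (y · z) ≡ y · (x · z)
·-swapˡ x y z = trans (sym (·-assoc x y z)) (trans (cong (_· z) (·-comm x y)) (·-assoc y x z))

⊕-cong : ∀ {A A' B B'} → A ≅ A' → B ≅ B' → A ⊕ B ≅ A' ⊕ B'
⊕-cong f g = record
  { to      = λ { (inj₁ a) → inj₁ (to f a) ; (inj₂ b) → inj₂ (to g b) }
  ; from    = λ { (inj₁ a) → inj₁ (from f a) ; (inj₂ b) → inj₂ (from g b) }
  ; to-from = λ { (inj₁ a) → cong inj₁ (to-from f a) ; (inj₂ b) → cong inj₂ (to-from g b) }
  ; from-to = λ { (inj₁ a) → cong inj₁ (from-to f a) ; (inj₂ b) → cong inj₂ (from-to g b) }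
  ; wt-to   = λ { (inj₁ a) → wt-to f a ; (inj₂ b) → wt-to g b } }

⊕-assoc : ∀ {A B C} → (A ⊕ B) ⊕ C ≅ A ⊕ (B ⊕ C)
⊕-assoc = record
  { to      = λ { (inj₁ (inj₁ a)) → inj₁ a ; (inj₁ (inj₂ b)) → inj₂ (inj₁ b) ; (inj₂ c) → inj₂ (inj₂ c) }
  ; from    = λ { (inj₁ a) → inj₁ (inj₁ a) ; (inj₂ (inj₁ b)) → inj₁ (inj₂ b) ; (inj₂ (inj₂ c)) → inj₂ c }
  ; to-from = λ { (inj₁ a) → refl ; (inj₂ (inj₁ b)) → refl ; (inj₂ (inj₂ c)) → refl }
  ; from-to = λ { (inj₁ (inj₁ a)) → refl ; (inj₁ (inj₂ b)) → refl ; (inj₂ c) → refl }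
  ; wt-to   = λ { (inj₁ (inj₁ a)) → refl ; (inj₁ (inj₂ b)) → refl ; (inj₂ c) → refl } }

⊕-swapˡ : ∀ {A B C} → A ⊕ (B ⊕ C) ≅ B ⊕ (A ⊕ C)
⊕-swapˡ = record
  { to      = rotate ; from = rotate
  ; to-from = rotate-rotate ; from-to = rotate-rotate
  ; wt-to   = λ { (inj₁ a) → refl ; (inj₂ (inj₁ b)) → refl ; (inj₂ (inj₂ c)) → refl } }
  where
  rotate : {A B C : Set} → A ⊎ (B ⊎ C) → B ⊎ (A ⊎ C)
  rotate (inj₁ a)        = inj₂ (inj₁ a)
  rotate (inj₂ (inj₁ b)) = inj₁ b
  rotate (inj₂ (inj₂ c)) = inj₂ (inj₂ c)
  rotate-rotate : {A B C : Set} (x : A ⊎ (B ⊎ C)) → rotate (rotate x) ≡ x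
  rotate-rotate (inj₁ a)        = refl
  rotate-rotate (inj₂ (inj₁ b)) = refl
  rotate-rotate (inj₂ (inj₂ c)) = refl

⊕-empty : ∀ {A B} → ¬ Obj B → A ≅ A ⊕ B
⊕-empty ¬b = record
  { to = inj₁ ; from = λ { (inj₁ a) → a ; (inj₂ b) → ⊥-elim (¬b b) }
  ; to-from = λ { (inj₁ a) → refl ; (inj₂ b) → ⊥-elim (¬b b) }
  ; from-to = λ _ → refl ; wt-to = λ _ → refl }

⊗-cong : ∀ {A A' B B'} → A ≅ A' → B ≅ B' → A ⊗ B ≅ A' ⊗ B'
⊗-cong f g = record
  { to      = λ (a , b) → to f a , to g b
  ; from    = λ (a , b) → from f a , from g b
  ; to-from = λ (a , b) → cong₂ _,_ (to-from f a) (to-from g b)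
  ; from-to = λ (a , b) → cong₂ _,_ (from-to f a) (from-to g b)
  ; wt-to   = λ (a , b) → cong₂ _·_ (wt-to f a) (wt-to g b) }

⊗-distribˡ-⊕ : ∀ {A B C} → A ⊗ (B ⊕ C) ≅ (A ⊗ B) ⊕ (A ⊗ C)
⊗-distribˡ-⊕ = record
  { to      = λ { (a , inj₁ b) → inj₁ (a , b) ; (a , inj₂ c) → inj₂ (a , c) }
  ; from    = λ { (inj₁ (a , b)) → a , inj₁ b ; (inj₂ (a , c)) → a , inj₂ c }
  ; to-from = λ { (inj₁ (a , b)) → refl ; (inj₂ (a , c)) → refl }
  ; from-to = λ { (a , inj₁ b) → refl ; (a , inj₂ c) → refl }
  ; wt-to   = λ { (a , inj₁ b) → refl ; (a , inj₂ c) → refl } }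

ΣW-cong : ∀ {I F G} → (∀ i → F i ≅ G i) → ΣW I F ≅ ΣW I G
ΣW-cong f = record
  { to      = λ (i , x) → i , to (f i) x
  ; from    = λ (i , y) → i , from (f i) y
  ; to-from = λ (i , y) → cong (i ,_) (to-from (f i) y)
  ; from-to = λ (i , x) → cong (i ,_) (from-to (f i) x)
  ; wt-to   = λ (i , x) → wt-to (f i) x }

ΣW-⊕ : ∀ {I F G} → ΣW I (λ i → F i ⊕ G i) ≅ ΣW I F ⊕ ΣW I G
ΣW-⊕ = record
  { to      = λ { (i , inj₁ x) → inj₁ (i , x) ; (i , inj₂ y) → inj₂ (i , y) }
  ; from    = λ { (inj₁ (i , x)) → i , inj₁ x ; (inj₂ (i , y)) → i , inj₂ y }
  ; to-from = λ { (inj₁ (i , x)) → refl ; (inj₂ (i , y)) → refl }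
  ; from-to = λ { (i , inj₁ x) → refl ; (i , inj₂ y) → refl }
  ; wt-to   = λ { (i , inj₁ x) → refl ; (i , inj₂ y) → refl } }

ΣW-ℕ : ∀ {F} → ΣW ℕ F ≅ F 0 ⊕ ΣW ℕ (F ∘ suc)
ΣW-ℕ = record
  { to      = λ { (zero , x) → inj₁ x ; (suc n , x) → inj₂ (n , x) }
  ; from    = λ { (inj₁ x) → zero , x ; (inj₂ (n , x)) → suc n , x }
  ; to-from = λ { (inj₁ x) → refl ; (inj₂ (n , x)) → refl }
  ; from-to = λ { (zero , x) → refl ; (suc n , x) → refl }
  ; wt-to   = λ { (zero , x) → refl ; (suc n , x) → refl } }

ΣW-truncate : ∀ {F} k → (∀ j → Obj (F j) → j ≤ k) → ΣW ℕ F ≅ sumTo k F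
ΣW-truncate {F} k bound = record
  { to      = λ (j , x) → fromℕ< (s≤s (bound j x)) , subst (Obj ∘ F) (sym (toℕ-fromℕ< _)) x
  ; from    = λ (i , x) → toℕ i , x
  ; to-from = λ (i , x) → Fin-≡ (toℕ-fromℕ< _) (subst-≡ (sym (toℕ-fromℕ< _)) x)
  ; from-to = λ (j , x) → sym (subst-≡ (sym (toℕ-fromℕ< _)) x)
  ; wt-to   = λ (j , x) → cong (λ (j , x) → wt (F j) x) (sym (subst-≡ (sym (toℕ-fromℕ< _)) x)) }
  where
  subst-≡ : ∀ {i j} (e : i ≡ j) (x : Obj (F i)) → (i , x) ≡ (j , subst (Obj ∘ F) e x)
  subst-≡ refl x = refl
  Fin-≡ : {i j : Fin (suc k)} {x : Obj (F (toℕ i))} {y : Obj (F (toℕ j))} → toℕ i ≡ toℕ j →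
    _≡_ {A = Σ ℕ (Obj ∘ F)} (toℕ j , y) (toℕ i , x) → _≡_ {A = Obj (sumTo k F)} (i , x) (j , y)
  Fin-≡ e e' with refl ← toℕ-injective e with refl ← e' = refl

scale-cong : ∀ {a b A B} → a ≡ b → A ≅ B → scale a A ≅ scale b B
scale-cong refl f = ΣW-cong (λ _ → f)

scale-index : ∀ {a} {I : Set} {A} → Fin a ↔ I → scale a A ≅ ΣW I (λ _ → A)
scale-index e = record
  { to      = λ (i , x) → Inverse.to e i , x
  ; from    = λ (i , x) → Inverse.from e i , x
  ; to-from = λ (i , x) → cong (_, x) (Inverse.strictlyInverseˡ e i)
  ; from-to = λ (i , x) → cong (_, x) (Inverse.strictlyInverseʳ e i)
  ; wt-to   = λ _ → refl }

scale-+ : ∀ {a b A} → scale (a + b) A ≅ scale a A ⊕ scale b A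
scale-+ {a} = ≅-trans (scale-index (+↔⊎ {a})) record
  { to      = λ { (inj₁ i , x) → inj₁ (i , x) ; (inj₂ i , x) → inj₂ (i , x) }
  ; from    = λ { (inj₁ (i , x)) → inj₁ i , x ; (inj₂ (i , x)) → inj₂ i , x }
  ; to-from = λ { (inj₁ (i , x)) → refl ; (inj₂ (i , x)) → refl }
  ; from-to = λ { (inj₁ i , x) → refl ; (inj₂ i , x) → refl }
  ; wt-to   = λ { (inj₁ i , x) → refl ; (inj₂ i , x) → refl } }

scale-* : ∀ {a b A} → scale (a * b) A ≅ scale a (scale b A)
scale-* {a} = ≅-trans (scale-index (*↔× {a})) record
  { to = λ ((i , j) , x) → i , (j , x) ; from = λ (i , (j , x)) → (i , j) , x
  ; to-from = λ _ → refl ; from-to = λ _ → refl ; wt-to = λ _ → refl }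

scale-1 : ∀ {A} → scale 1 A ≅ A
scale-1 = record
  { to = proj₂ ; from = Fin.zero ,_
  ; to-from = λ _ → refl ; from-to = λ { (Fin.zero , _) → refl } ; wt-to = λ _ → refl }

scale-suc : ∀ {a A} → scale (suc a) A ≅ A ⊕ scale a A
scale-suc {a} = ≅-trans (scale-+ {1} {a}) (⊕-cong scale-1 ≅-refl)

scale-⊕ : ∀ {a A B} → scale a (A ⊕ B) ≅ scale a A ⊕ scale a B
scale-⊕ = ΣW-⊕

-- Young diagrams as finite down-closed sets of cells

data Orientation : Set where
  hor ver : Orientation

-- 0-indexed: position b of line a, lines being rows (hor) or columns (ver).
cell : Orientation → ℕ → ℕ → Cell
cell hor a b = suc a , suc b
cell ver a b = suc b , suc a

cell-injective : ∀ o {a b a' b'} → cell o a b ≡ cell o a' b' → a ≡ a' × b ≡ b'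
cell-injective hor refl = refl , refl
cell-injective ver refl = refl , refl

_≟ᶜ_ : (c d : Cell) → Dec (c ≡ d)
_≟ᶜ_ = ≡-dec _≟_ _≟_

infix 4 _∋_
-- A record, so that the cell can be inferred from a membership proof.
record _∋_ (α : Partition) (c : Cell) : Set where
  constructor ∋-intro
  field
    ∋-elim : T (inDiagram α c)
open _∋_

_∋?_ : ∀ α c → Dec (α ∋ c)
α ∋? c = map′ ∋-intro ∋-elim (T? _)

∋⇒<rowLen : ∀ α {a b} → α ∋ (suc a , suc b) → b < rowLen (parts α) (suc a)
∋⇒<rowLen α {a} {b} (∋-intro p) = <ᵇ⇒< b (rowLen (parts α) (suc a)) p

<rowLen⇒∋ : ∀ α {a b} → b < rowLen (parts α) (suc a) → α ∋ (suc a , suc b)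
<rowLen⇒∋ α p = ∋-intro (<⇒<ᵇ p)

rowLen-antitone : ∀ rs → T (isPartition rs) → ∀ a → rowLen rs (suc (suc a)) ≤ rowLen rs (suc a)
rowLen-antitone []           _ a       = z≤n
rowLen-antitone (r ∷ [])     _ a       = z≤n
rowLen-antitone (r ∷ s ∷ rs) v zero    = ≤ᵇ⇒≤ s r (proj₁ (Equivalence.to T-∧ v))
rowLen-antitone (r ∷ s ∷ rs) v (suc a) = rowLen-antitone (s ∷ rs) (proj₂ (Equivalence.to (T-∧ {s ≤ᵇ r}) v)) a

∋-pred : ∀ α o a b → α ∋ cell o (suc a) b → α ∋ cell o a b
∋-pred α hor a b p = <rowLen⇒∋ α (≤-trans (∋⇒<rowLen α p) (rowLen-antitone (parts α) (Partition.valid α) a))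
∋-pred α ver a b p = <rowLen⇒∋ α (≤-trans (n≤1+n (suc a)) (∋⇒<rowLen α p))

∋-predʳ : ∀ α o a b → α ∋ cell o a (suc b) → α ∋ cell o a b
∋-predʳ α hor a b = ∋-pred α ver b a
∋-predʳ α ver a b = ∋-pred α hor b a

data Bounded (N : ℕ) : Cell → Set where
  bounded : ∀ {a b} → a < N → b < N → Bounded N (suc a , suc b)

Bounded-mono : ∀ {M N c} → M ≤ N → Bounded M c → Bounded N c
Bounded-mono M≤N (bounded p q) = bounded (≤-trans p M≤N) (≤-trans q M≤N)

rowLen≤first : ∀ rs → T (isPartition rs) → ∀ a → rowLen rs (suc a) ≤ rowLen rs 1
rowLen≤first rs v zero    = ≤-refl
rowLen≤first rs v (suc a) = ≤-trans (rowLen-antitone rs v a) (rowLen≤first rs v a)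

rowLen>0⇒<length : ∀ rs a b → b < rowLen rs (suc a) → a < length rs
rowLen>0⇒<length []       a       b ()
rowLen>0⇒<length (r ∷ rs) zero    b _ = s≤s z≤n
rowLen>0⇒<length (r ∷ rs) (suc a) b p = s≤s (rowLen>0⇒<length rs a b p)

size : Partition → ℕ
size α = length (parts α) + rowLen (parts α) 1

∋⇒Bounded : ∀ α {c} → α ∋ c → Bounded (size α) c
∋⇒Bounded α {suc a , zero}  (∋-intro ())
∋⇒Bounded α {suc a , suc b} p = bounded
  (≤-trans (rowLen>0⇒<length (parts α) a b q) (m≤m+n _ _))
  (≤-trans (≤-trans q (rowLen≤first (parts α) (Partition.valid α) a)) (m≤n+m _ _))
  where q = ∋⇒<rowLen α p

isPartition-tail : ∀ r rs → T (isPartition (r ∷ rs)) → T (isPartition rs)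
isPartition-tail r []       _ = tt
isPartition-tail r (s ∷ rs) v = proj₂ (Equivalence.to (T-∧ {s ≤ᵇ r}) v)

head>0 : ∀ r rs → T (isPartition (r ∷ rs)) → 0 < r
head>0 r []       v = ≤ᵇ⇒≤ 1 r v
head>0 r (s ∷ rs) v = ≤-trans (head>0 s rs (isPartition-tail r (s ∷ rs) v))
                              (≤ᵇ⇒≤ s r (proj₁ (Equivalence.to T-∧ v)))

rowLen-injective : ∀ rs ss → T (isPartition rs) → T (isPartition ss) →
  (∀ a → rowLen rs (suc a) ≡ rowLen ss (suc a)) → rs ≡ ss
rowLen-injective []       []       _ _ _ = refl
rowLen-injective []       (s ∷ ss) _ w e = contradiction (e 0) (<⇒≢ (head>0 s ss w))
rowLen-injective (r ∷ rs) []       v _ e = contradiction (sym (e 0)) (<⇒≢ (head>0 r rs v))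
rowLen-injective (r ∷ rs) (s ∷ ss) v w e = cong₂ _∷_ (e 0)
  (rowLen-injective rs ss (isPartition-tail r rs v) (isPartition-tail s ss w) (e ∘ suc))

<-ext : ∀ m n → (∀ b → b < m → b < n) → (∀ b → b < n → b < m) → m ≡ n
<-ext m n f g = ≤-antisym (≮⇒≥ λ n<m → <-irrefl refl (f n n<m)) (≮⇒≥ λ m<n → <-irrefl refl (g m m<n))

-- Lets shapes reached by different moves be compared cell by cell. Parts are positive, so the row
-- lengths determine the list.
Partition-ext : ∀ {α β} → (∀ {c} → α ∋ c → β ∋ c) → (∀ {c} → β ∋ c → α ∋ c) → α ≡ β
Partition-ext {mkPartition rs v} {mkPartition ss w} f g
  with refl ← rowLen-injective rs ss v w (λ a → <-ext _ _
         (λ b p → ∋⇒<rowLen (mkPartition ss w) (f (<rowLen⇒∋ (mkPartition rs v) p)))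
         (λ b p → ∋⇒<rowLen (mkPartition rs v) (g (<rowLen⇒∋ (mkPartition ss w) p))))
  = cong (mkPartition rs) (T-irrelevant v w)

-- Meant for down-closed predicates whose solutions lie below `N`: the initial run then contains
-- every solution, and the bounded search yields a row or column length.
runLen : {Q : ℕ → Set} → ℕ → (∀ b → Dec (Q b)) → ℕ
runLen zero    Q? = 0
runLen (suc N) Q? with Q? 0
... | yes _ = suc (runLen N (Q? ∘ suc))
... | no  _ = 0

initial : {Q : ℕ → Set} → (∀ b → Q (suc b) → Q b) → ∀ b → Q b → Q 0
initial down zero    q = q
initial down (suc b) q = initial down b (down b q)

runLen-sound : ∀ {Q : ℕ → Set} N (Q? : ∀ b → Dec (Q b)) b → b < runLen N Q? → Q b
runLen-sound (suc N) Q? b p with Q? 0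
runLen-sound (suc N) Q? zero    p       | yes q = q
runLen-sound (suc N) Q? (suc b) (s≤s p) | yes q = runLen-sound N (Q? ∘ suc) b p
runLen-sound (suc N) Q? b       ()      | no _

runLen-complete : ∀ {Q : ℕ → Set} N (Q? : ∀ b → Dec (Q b)) →
  (∀ b → Q (suc b) → Q b) → ∀ b → b < N → Q b → b < runLen N Q?
runLen-complete (suc N) Q? down b p q with Q? 0
runLen-complete (suc N) Q? down b       p       q | no ¬q = ⊥-elim (¬q (initial down b q))
runLen-complete (suc N) Q? down zero    p       q | yes _ = s≤s z≤n
runLen-complete (suc N) Q? down (suc b) (s≤s p) q | yes _ =
  s≤s (runLen-complete N (Q? ∘ suc) (down ∘ suc) b p q)

-- Rows and columns are measured by the same search, so no conjugate partition is needed. `size α`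
-- exceeds every 0-based coordinate in the diagram.
len : Orientation → Partition → ℕ → ℕ
len o α a = runLen (size α) (λ b → α ∋? cell o a b)

<len⇒∋ : ∀ o α a b → b < len o α a → α ∋ cell o a b
<len⇒∋ o α a b = runLen-sound (size α) _ b

∋⇒<len : ∀ o α a b → α ∋ cell o a b → b < len o α a
∋⇒<len o α a b p = runLen-complete (size α) _ (∋-predʳ α o a) b (bound o (∋⇒Bounded α p)) p
  where
  bound : ∀ o {N} → Bounded N (cell o a b) → b < N
  bound hor (bounded _ q) = q
  bound ver (bounded q _) = q

-- Stopping at the first empty row keeps all parts positive, and no later row is lost when `r` is
-- weakly decreasing.
fromRows : ℕ → (ℕ → ℕ) → List ℕ
fromRows zero    r = []
fromRows (suc N) r with r 0
... | zero  = []
... | suc k = suc k ∷ fromRows N (r ∘ suc)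

fromRows-valid : ∀ N r → (∀ a → r (suc a) ≤ r a) → T (isPartition (fromRows N r))
fromRows-valid zero    r anti = tt
fromRows-valid (suc N) r anti with r 0 in eq
... | zero  = tt
... | suc k = cons N (r ∘ suc) (subst (r 1 ≤_) eq (anti 0)) (fromRows-valid N (r ∘ suc) (anti ∘ suc))
  where
  cons : ∀ N r → r 0 ≤ suc k → T (isPartition (fromRows N r)) → T (isPartition (suc k ∷ fromRows N r))
  cons zero    r _ _ = tt
  cons (suc N) r p v with r 0
  ... | zero  = tt
  ... | suc l = Equivalence.from T-∧ (≤⇒≤ᵇ p , v)

rowLen-fromRows : ∀ N r → (∀ a → r (suc a) ≤ r a) → r N ≡ 0 → ∀ a → rowLen (fromRows N r) (suc a) ≡ r a
rowLen-fromRows zero    r anti z zero    = sym z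
rowLen-fromRows zero    r anti z (suc a) =
  rowLen-fromRows zero (r ∘ suc) (anti ∘ suc) (n≤0⇒n≡0 (≤-trans (anti 0) (≤-reflexive z))) a
rowLen-fromRows (suc N) r anti z a with r 0 in eq
rowLen-fromRows (suc N) r anti z zero    | zero  = sym eq
rowLen-fromRows (suc N) r anti z (suc a) | zero  =
  rowLen-fromRows zero (r ∘ suc) (anti ∘ suc) (n≤0⇒n≡0 (≤-trans (anti 0) (≤-reflexive eq))) a
rowLen-fromRows (suc N) r anti z zero    | suc k = sym eq
rowLen-fromRows (suc N) r anti z (suc a) | suc k = rowLen-fromRows N (r ∘ suc) (anti ∘ suc) z a

module _ (P : Cell → Set) (P? : ∀ c → Dec (P c)) (N : ℕ)
         (P-bounded : ∀ {c} → P c → Bounded N c)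
         (P-pred : ∀ o a b → P (cell o (suc a) b) → P (cell o a b)) where

  private
    row : ℕ → ℕ
    row a = runLen N (λ b → P? (cell hor a b))

    row-complete : ∀ a b → P (cell hor a b) → b < row a
    row-complete a b p with bounded _ q ← P-bounded {cell hor a b} p =
      runLen-complete N _ (λ b → P-pred ver b a) b q p

    row-antitone : ∀ a → row (suc a) ≤ row a
    row-antitone a = ≮⇒≥ λ lt → <-irrefl refl
      (row-complete a (row a) (P-pred hor a (row a) (runLen-sound N _ (row a) lt)))

    row-N : row N ≡ 0
    row-N = n≤0⇒n≡0 (≮⇒≥ λ lt → absurd (P-bounded (runLen-sound N _ 0 lt)))
      where
      absurd : Bounded N (suc N , 1) → ⊥
      absurd (bounded p _) = <-irrefl refl p

  -- Every shape obtained by a domino move is described by its set of cells and converted here, so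
  -- the moves themselves never manipulate lists of parts.
  fromPredicate : Partition
  fromPredicate = mkPartition (fromRows N row) (fromRows-valid N row row-antitone)

  fromPredicate-sound : ∀ {c} → fromPredicate ∋ c → P c
  fromPredicate-sound p with ∋⇒Bounded fromPredicate p
  ... | bounded {a} {b} _ _ = runLen-sound N _ b
    (subst (b <_) (rowLen-fromRows N row row-antitone row-N a) (∋⇒<rowLen fromPredicate p))

  fromPredicate-complete : ∀ {c} → P c → fromPredicate ∋ c
  fromPredicate-complete p with P-bounded p
  ... | bounded {a} {b} _ _ = <rowLen⇒∋ fromPredicate
    (subst (b <_) (sym (rowLen-fromRows N row row-antitone row-N a)) (row-complete a b p))

-- Dominoes

-- Coordinates across and along the domino, instead of row and column, let one argument serve both
-- orientations.
record Domino : Set where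
  constructor domino
  field
    orient   : Orientation
    line pos : ℕ

first second : Domino → Cell
first  (domino o a b) = cell o a b
second (domino o a b) = cell o a (suc b)

infix 4 _∈ᵈ_ _∈ᵈ?_
_∈ᵈ_ : Cell → Domino → Set
c ∈ᵈ d = c ≡ first d ⊎ c ≡ second d

_∈ᵈ?_ : ∀ c d → Dec (c ∈ᵈ d)
c ∈ᵈ? d = (c ≟ᶜ first d) ⊎-dec (c ≟ᶜ second d)

record IsStep (α β : Partition) (d : Domino) : Set where
  field
    new  : ∀ {c} → c ∈ᵈ d → ¬ α ∋ c
    old  : ∀ {c} → c ∈ᵈ d → β ∋ c
    incl : ∀ {c} → α ∋ c → β ∋ c
    excl : ∀ {c} → β ∋ c → ¬ c ∈ᵈ d → α ∋ c

-- IsStep is a family of decidable facts, so it can be kept irrelevant and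
-- recomputed cell by cell; a step is then determined by its domino.
record Step (α β : Partition) : Set where
  constructor mkStep
  field
    dom     : Domino
    .isStep : IsStep α β dom
open Step

step-spec : ∀ {α β} (s : Step α β) → IsStep α β (dom s)
step-spec {α} {β} (mkStep d s) = record
  { new  = λ {c} p q → recompute (no id) (IsStep.new s p q)
  ; old  = λ {c} p → recompute (_ ∋? c) (IsStep.old s p)
  ; incl = λ {c} p → recompute (_ ∋? c) (IsStep.incl s p)
  ; excl = λ {c} p q → recompute (_ ∋? c) (IsStep.excl s p q) }

target-unique : ∀ {α β β' d} → IsStep α β d → IsStep α β' d → β ≡ β'
target-unique {d = d} s t = Partition-ext (half s t) (half t s)
  where
  half : ∀ {α β β'} → IsStep α β d → IsStep α β' d → ∀ {c} → β ∋ c → β' ∋ c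
  half s t {c} p with c ∈ᵈ? d
  ... | yes q = IsStep.old t q
  ... | no ¬q = IsStep.incl t (IsStep.excl s p ¬q)

source-unique : ∀ {α α' β d} → IsStep α β d → IsStep α' β d → α ≡ α'
source-unique s t = Partition-ext (half s t) (half t s)
  where
  half : ∀ {α α' β d} → IsStep α β d → IsStep α' β d → ∀ {c} → α ∋ c → α' ∋ c
  half s t p = IsStep.excl t (IsStep.incl s p) (λ q → IsStep.new s q p)

∈ᵈ-bounded : ∀ d → ∃ λ N → ∀ {c} → c ∈ᵈ d → Bounded N c
∈ᵈ-bounded (domino o a b) = suc (suc (a + b)) , λ
  { (inj₁ refl) → go o (s≤s (≤-trans (m≤m+n a b) (n≤1+n _))) (s≤s (≤-trans (m≤n+m b a) (n≤1+n _)))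
  ; (inj₂ refl) → go o (s≤s (≤-trans (m≤m+n a b) (n≤1+n _))) (s≤s (s≤s (m≤n+m b a))) }
  where
  go : ∀ o {N a b} → a < N → b < N → Bounded N (cell o a b)
  go hor p q = bounded p q
  go ver p q = bounded q p

module _ (α : Partition) (d : Domino) where

  -- Only the predecessors of the new cells can violate down-closure, so `closed` is asked of these
  -- alone. With `o` ranging over both orientations it covers the upper and the left neighbours.
  addDomino : (∀ {c} → c ∈ᵈ d → ¬ α ∋ c) →
    (∀ o a b → cell o (suc a) b ∈ᵈ d → α ∋ cell o a b ⊎ cell o a b ∈ᵈ d) →
    Σ Partition λ β → IsStep α β d
  addDomino new closed =
    fromPredicate P P? (size α ⊔ N) P-bounded P-pred , record
    { new  = new
    ; old  = λ p → fromPredicate-complete P P? _ P-bounded P-pred (inj₂ p)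
    ; incl = λ p → fromPredicate-complete P P? _ P-bounded P-pred (inj₁ p)
    ; excl = λ p ¬q → case¬q ¬q (fromPredicate-sound P P? _ P-bounded P-pred p) }
    where
    P : Cell → Set
    P c = α ∋ c ⊎ c ∈ᵈ d
    P? : ∀ c → Dec (P c)
    P? c = (α ∋? c) ⊎-dec (c ∈ᵈ? d)
    N = proj₁ (∈ᵈ-bounded d)
    P-bounded : ∀ {c} → P c → Bounded (size α ⊔ N) c
    P-bounded (inj₁ p) = Bounded-mono (m≤m⊔n _ N) (∋⇒Bounded α p)
    P-bounded (inj₂ p) = Bounded-mono (m≤n⊔m (size α) N) (proj₂ (∈ᵈ-bounded d) p)
    P-pred : ∀ o a b → P (cell o (suc a) b) → P (cell o a b)
    P-pred o a b (inj₁ p) = inj₁ (∋-pred α o a b p)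
    P-pred o a b (inj₂ p) = closed o a b p
    case¬q : ∀ {A B : Set} → ¬ B → A ⊎ B → A
    case¬q ¬b (inj₁ a) = a
    case¬q ¬b (inj₂ b) = ⊥-elim (¬b b)

  removeDomino : (∀ {c} → c ∈ᵈ d → α ∋ c) →
    (∀ o a b → cell o a b ∈ᵈ d → α ∋ cell o (suc a) b → cell o (suc a) b ∈ᵈ d) →
    Σ Partition λ δ → IsStep δ α d
  removeDomino old closed =
    fromPredicate P P? (size α) P-bounded P-pred , record
    { new  = λ p q → proj₂ (fromPredicate-sound P P? _ P-bounded P-pred q) p
    ; old  = old
    ; incl = λ p → proj₁ (fromPredicate-sound P P? _ P-bounded P-pred p)
    ; excl = λ p ¬q → fromPredicate-complete P P? _ P-bounded P-pred (p , ¬q) }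
    where
    P : Cell → Set
    P c = α ∋ c × ¬ c ∈ᵈ d
    P? : ∀ c → Dec (P c)
    P? c = (α ∋? c) ×-dec ¬? (c ∈ᵈ? d)
    P-bounded : ∀ {c} → P c → Bounded (size α) c
    P-bounded (p , _) = ∋⇒Bounded α p
    P-pred : ∀ o a b → P (cell o (suc a) b) → P (cell o a b)
    P-pred o a b (p , ¬q) = ∋-pred α o a b p , λ q → ¬q (closed o a b q p)

-- Local moves of dominoes

-- Both round trips follow once the correspondence is functional and injective. A bijection given by
-- cases can thus be checked on a relation, without evaluating the nested case splits of its two
-- maps.
fromRelation : ∀ {A B} (R : Obj A → Obj B → Set) →
  (∀ a → Σ (Obj B) (R a)) → (∀ b → Σ (Obj A) λ a → R a b) →
  (∀ {a b b'} → R a b → R a b' → b ≡ b') → (∀ {a a' b} → R a b → R a' b → a ≡ a') →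
  (∀ {a b} → R a b → wt B b ≡ wt A a) → A ≅ B
fromRelation R total surj functional injective wt-R = record
  { to      = proj₁ ∘ total
  ; from    = proj₁ ∘ surj
  ; to-from = λ b → functional (proj₂ (total _)) (proj₂ (surj b))
  ; from-to = λ a → injective (proj₂ (surj _)) (proj₂ (total a))
  ; wt-to   = λ a → wt-R (proj₂ (total a)) }

cell-other : ∀ {o o'} → o ≢ o' → ∀ a b → cell o a b ≡ cell o' b a
cell-other {hor} {hor} ne a b = ⊥-elim (ne refl)
cell-other {hor} {ver} ne a b = refl
cell-other {ver} {hor} ne a b = refl
cell-other {ver} {ver} ne a b = ⊥-elim (ne refl)

_≟ᵒ_ : (o o' : Orientation) → Dec (o ≡ o')
hor ≟ᵒ hor = yes refl
hor ≟ᵒ ver = no λ ()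
ver ≟ᵒ hor = no λ ()
ver ≟ᵒ ver = yes refl

-- A neighbour in direction `o'` lies either across or along the lines of `o`; this replaces a case
-- split on pairs of orientations.
successors : ∀ o {P : Cell → Cell → Set} →
  (∀ a b → P (cell o a b) (cell o (suc a) b)) → (∀ a b → P (cell o a b) (cell o a (suc b))) →
  ∀ o' a b → P (cell o' a b) (cell o' (suc a) b)
successors hor f g hor a b = f a b
successors hor f g ver a b = g b a
successors ver f g hor a b = g b a
successors ver f g ver a b = f a b

-- One extremal cell per side is enough: by down-closure the second cell is as new as the first, and
-- the cell before `above` is present too.
addable : ∀ α o a b → ¬ α ∋ cell o a b → (∀ a' → a ≡ suc a' → α ∋ cell o a' (suc b)) →
  (∀ b' → b ≡ suc b' → α ∋ cell o a b') → Σ Partition λ β → IsStep α β (domino o a b)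
addable α o a b new above left = addDomino α (domino o a b)
  (λ { (inj₁ refl) → new ; (inj₂ refl) → new ∘ ∋-predʳ α o a b })
  (successors o {λ c c' → c' ∈ᵈ domino o a b → α ∋ c ⊎ c ∈ᵈ domino o a b}
    (λ { x y (inj₁ e) → inj₁ (row x y e) ; x y (inj₂ e) → inj₁ (row' x y e) })
    (λ { x y (inj₁ e) → inj₁ (col x y e) ; x y (inj₂ e) → inj₂ (inj₁ (col' x y e)) }))
  where
  row : ∀ x y → cell o (suc x) y ≡ cell o a b → α ∋ cell o x y
  row x y e with refl , refl ← cell-injective o e = ∋-predʳ α o x y (above x refl)
  row' : ∀ x y → cell o (suc x) y ≡ cell o a (suc b) → α ∋ cell o x y
  row' x y e with refl , refl ← cell-injective o e = above x refl
  col : ∀ x y → cell o x (suc y) ≡ cell o a b → α ∋ cell o x y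
  col x y e with refl , refl ← cell-injective o e = left y refl
  col' : ∀ x y → cell o x (suc y) ≡ cell o a (suc b) → cell o x y ≡ cell o a b
  col' x y e with refl , refl ← cell-injective o e = refl

removable : ∀ α o a b → α ∋ cell o a (suc b) → ¬ α ∋ cell o a (suc (suc b)) → ¬ α ∋ cell o (suc a) b →
  Σ Partition λ δ → IsStep δ α (domino o a b)
removable α o a b old right below = removeDomino α (domino o a b)
  (λ { (inj₁ refl) → ∋-predʳ α o a b old ; (inj₂ refl) → old })
  (successors o {λ c c' → c ∈ᵈ domino o a b → α ∋ c' → c' ∈ᵈ domino o a b}
    (λ { x y (inj₁ e) p → ⊥-elim (row x y e p) ; x y (inj₂ e) p → ⊥-elim (row' x y e p) })
    (λ { x y (inj₁ e) p → inj₂ (col x y e) ; x y (inj₂ e) p → ⊥-elim (col' x y e p) }))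
  where
  row : ∀ x y → cell o x y ≡ cell o a b → ¬ α ∋ cell o (suc x) y
  row x y e with refl , refl ← cell-injective o e = below
  row' : ∀ x y → cell o x y ≡ cell o a (suc b) → ¬ α ∋ cell o (suc x) y
  row' x y e with refl , refl ← cell-injective o e = below ∘ ∋-predʳ α o (suc x) b
  col : ∀ x y → cell o x y ≡ cell o a b → cell o x (suc y) ≡ cell o a (suc b)
  col x y e with refl , refl ← cell-injective o e = refl
  col' : ∀ x y → cell o x y ≡ cell o a (suc b) → ¬ α ∋ cell o x (suc y)
  col' x y e with refl , refl ← cell-injective o e = right

∉ᵈ-line : ∀ {o a b x y} → x ≢ a → ¬ cell o x y ∈ᵈ domino o a b
∉ᵈ-line {o} ne (inj₁ e) = ne (proj₁ (cell-injective o e))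
∉ᵈ-line {o} ne (inj₂ e) = ne (proj₁ (cell-injective o e))

module _ {α β : Partition} {o : Orientation} {a b : ℕ} (s : IsStep α β (domino o a b)) where
  open IsStep s

  left-∋ : ∀ b' → b ≡ suc b' → α ∋ cell o a b'
  left-∋ b' refl = excl (∋-predʳ β o a b' (old (inj₁ refl)))
    λ { (inj₁ e) → 1+n≢n (sym (proj₂ (cell-injective o e)))
      ; (inj₂ e) → <⇒≢ (n≤1+n (suc b')) (proj₂ (cell-injective o e)) }

  above-∋ : ∀ a' → a ≡ suc a' → α ∋ cell o a' (suc b)
  above-∋ a' refl = excl (∋-pred β o a' (suc b) (old (inj₂ refl))) (∉ᵈ-line (1+n≢n ∘ sym))

  right-∌ : ¬ β ∋ cell o a (suc (suc b))
  right-∌ p = new (inj₂ refl) (∋-predʳ α o a (suc b) (excl p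
    λ { (inj₁ e) → <⇒≢ (n≤1+n (suc b)) (sym (proj₂ (cell-injective o e)))
      ; (inj₂ e) → 1+n≢n (proj₂ (cell-injective o e)) }))

  below-∌ : ¬ β ∋ cell o (suc a) b
  below-∌ p = new (inj₁ refl) (∋-pred α o a b (excl p (∉ᵈ-line 1+n≢n)))

  -- The length of a line forces the position of a domino added to it, and likewise of one removed.
  -- Hence a line has at most one addable and one removable domino, and lines can serve as labels
  -- for dominoes.
  pos≡len : b ≡ len o α a
  pos≡len = ≤-antisym (b≤len b left-∋) (≮⇒≥ (new (inj₁ refl) ∘ <len⇒∋ o α a b))
    where
    b≤len : ∀ b → (∀ b' → b ≡ suc b' → α ∋ cell o a b') → b ≤ len o α a
    b≤len zero     _ = z≤n
    b≤len (suc b') f = ∋⇒<len o α a b' (f b' refl)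

  len≡2+pos : len o β a ≡ 2 + b
  len≡2+pos = ≤-antisym (≮⇒≥ (right-∌ ∘ <len⇒∋ o β a _)) (∋⇒<len o β a (suc b) (old (inj₂ refl)))

  pos≡len∸2 : b ≡ len o β a ∸ 2
  pos≡len∸2 = sym (cong (_∸ 2) len≡2+pos)

-- The dominoes addable along line a + 1 correspond to those removable
-- along line a; line 0 always has exactly one addable domino.
data LineShift (α : Partition) : Domino → Domino ⊎ Orientation → Set where
  edge : ∀ {o b} → b ≡ len o α 0 → LineShift α (domino o 0 b) (inj₂ o)
  line : ∀ {o a b b'} → b ≡ len o α (suc a) → b' ≡ len o α a ∸ 2 →
         LineShift α (domino o (suc a) b) (inj₁ (domino o a b'))

LineShift-functional : ∀ {α d r r'} → LineShift α d r → LineShift α d r' → r ≡ r'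
LineShift-functional (edge _)      (edge _)      = refl
LineShift-functional (line _ refl) (line _ refl) = refl

LineShift-injective : ∀ {α d d' r} → LineShift α d r → LineShift α d' r → d ≡ d'
LineShift-injective (edge refl)   (edge refl)   = refl
LineShift-injective (line refl _) (line refl _) = refl

addable-edge : ∀ α o → ∃ λ β → IsStep α β (domino o 0 (len o α 0))
addable-edge α o = addable α o 0 _ (λ p → <-irrefl refl (∋⇒<len o α 0 _ p)) (λ _ ())
  (λ b' e → <len⇒∋ o α 0 b' (≤-reflexive (sym e)))

-- A removable domino on line `a` overhangs line `a + 1` by two cells, which leaves room for a
-- domino at the end of that line.
addable-below : ∀ {α δ o a b} → IsStep δ α (domino o a b) →
  ∃ λ β → IsStep α β (domino o (suc a) (len o α (suc a)))
addable-below {α} {δ} {o} {a} {b} s = addable α o (suc a) _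
  (λ p → <-irrefl refl (∋⇒<len o α (suc a) _ p))
  (λ { _ refl → <len⇒∋ o α a _ (subst (suc (len o α (suc a)) <_) (sym (len≡2+pos s))
    (s≤s (s≤s (≮⇒≥ (below-∌ s ∘ <len⇒∋ o α (suc a) b))))) })
  (λ b' e → <len⇒∋ o α (suc a) b' (≤-reflexive (sym e)))

-- The domino added on line `a + 1` lies entirely next to cells of line `a`. So line `a` is longer
-- than line `a + 1` by at least two, and its last two cells are free to go; the lengths 0 and 1 are
-- impossible.
removable-above : ∀ {α β o a b} → IsStep α β (domino o (suc a) b) →
  ∃ λ δ → IsStep δ α (domino o a (len o α a ∸ 2))
removable-above {α} {β} {o} {a} {b} s with len o α a in eq
... | zero        with () ← subst (suc b <_) eq (∋⇒<len o α a (suc b) (above-∋ s a refl))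
... | suc zero    with s≤s () ← subst (suc b <_) eq (∋⇒<len o α a (suc b) (above-∋ s a refl))
... | suc (suc l) = removable α o a l
  (<len⇒∋ o α a (suc l) (≤-reflexive (sym eq)))
  (λ p → <-irrefl (sym eq) (∋⇒<len o α a (suc (suc l)) p))
  (λ p → IsStep.new s (inj₁ refl) (<len⇒∋ o α (suc a) b
    (≤-trans (s≤s b≤l) (∋⇒<len o α (suc a) l p))))
  where
  b≤l : b ≤ l
  b≤l with s≤s (s≤s p) ← subst (suc b <_) eq (∋⇒<len o α a (suc b) (above-∋ s a refl)) = p

Disjoint : Domino → Domino → Set
Disjoint d d' = ∀ {c} → c ∈ᵈ d → ¬ c ∈ᵈ d'

-- `δ` is the intersection of `α` and `γ`. Taking `d'` from `α` keeps down-closure: a successor of a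
-- cell of `d'` that lies in `α` belongs to `β` but not to `γ`, so it is in `d'`.
split-square : ∀ {α β γ d d'} → IsStep α β d → IsStep γ β d' → Disjoint d d' →
  ∃ λ δ → IsStep δ α d' × IsStep δ γ d
split-square {α} {β} {γ} {d} {d'} s s' disj = δ , t , record
  { new  = λ p q → IsStep.new s p (IsStep.incl t q)
  ; old  = λ p → IsStep.excl s' (IsStep.old s p) (disj p)
  ; incl = λ q → IsStep.excl s' (IsStep.incl s (IsStep.incl t q)) (λ p → IsStep.new t p q)
  ; excl = λ q ¬p → IsStep.excl t (IsStep.excl s (IsStep.incl s' q) ¬p) (λ p → IsStep.new s' p q) }
  where
  removed : ∃ λ δ → IsStep δ α d'
  removed = removeDomino α d'
    (λ p → IsStep.excl s (IsStep.old s' p) (λ q → disj q p))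
    (λ o a b p q → ∈-d' (IsStep.incl s q) (λ r → IsStep.new s' p (∋-pred γ o a b r)))
    where
    ∈-d' : ∀ {c} → β ∋ c → ¬ γ ∋ c → c ∈ᵈ d'
    ∈-d' {c} p ¬q with c ∈ᵈ? d'
    ... | yes r = r
    ... | no ¬r = ⊥-elim (¬q (IsStep.excl s' p ¬r))
  δ = proj₁ removed
  t = proj₂ removed

-- `β` is the union of `α` and `γ`: a predecessor of a cell of `d` lies in `γ`, hence in `d` or
-- already in `δ`.
join-square : ∀ {α δ γ d d'} → IsStep δ α d' → IsStep δ γ d → Disjoint d d' →
  ∃ λ β → IsStep α β d × IsStep γ β d'
join-square {α} {δ} {γ} {d} {d'} t t' disj = β , s , record
  { new  = λ p q → IsStep.new t p (IsStep.excl t' q (λ r → disj r p))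
  ; old  = λ p → IsStep.incl s (IsStep.old t p)
  ; incl = λ {c} q → incl' q (c ∈ᵈ? d)
  ; excl = λ {c} q ¬p → excl' q ¬p (c ∈ᵈ? d) }
  where
  new' : ∀ {c} → c ∈ᵈ d → ¬ α ∋ c
  new' p q = IsStep.new t' p (IsStep.excl t q (disj p))
  added : ∃ λ β → IsStep α β d
  added = addDomino α d new' λ o a b p → closed o a b p (cell o a b ∈ᵈ? d)
    where
    closed : ∀ o a b → cell o (suc a) b ∈ᵈ d → Dec (cell o a b ∈ᵈ d) → α ∋ cell o a b ⊎ cell o a b ∈ᵈ d
    closed o a b p (yes q) = inj₂ q
    closed o a b p (no ¬q) = inj₁ (IsStep.incl t (IsStep.excl t' (∋-pred γ o a b (IsStep.old t' p)) ¬q))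
  β = proj₁ added
  s = proj₂ added
  incl' : ∀ {c} → γ ∋ c → Dec (c ∈ᵈ d) → β ∋ c
  incl' q (yes p) = IsStep.old s p
  incl' q (no ¬p) = IsStep.incl s (IsStep.incl t (IsStep.excl t' q ¬p))
  excl' : ∀ {c} → β ∋ c → ¬ c ∈ᵈ d' → Dec (c ∈ᵈ d) → γ ∋ c
  excl' q ¬p (yes r) = IsStep.old t' r
  excl' q ¬p (no ¬r) = IsStep.incl t' (IsStep.excl t (IsStep.excl s q ¬r) ¬p)

module _ {o o' : Orientation} {a b : ℕ} (o≢o' : o ≢ o') where
  private
    flip-∋ : ∀ {α x y} → α ∋ cell o x y → α ∋ cell o' y x
    flip-∋ {α} = subst (α ∋_) (cell-other o≢o' _ _)
    unflip-∋ : ∀ {α x y} → α ∋ cell o' y x → α ∋ cell o x y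
    unflip-∋ {α} = subst (α ∋_) (sym (cell-other o≢o' _ _))

  -- The corner cell (a , b) takes over the role of (a + 1 , b + 1), in which the two dominoes overlap.
  split-corner : ∀ {α β γ} → IsStep α β (domino o (suc a) b) → IsStep γ β (domino o' (suc b) a) →
    ∃ λ δ → IsStep δ α (domino o a b) × IsStep δ γ (domino o' b a)
  split-corner {α} {β} {γ} s s' = δ , t , record
    { new  = λ { (inj₁ refl) q → IsStep.new t (inj₁ refl) (unflip-∋ q)
               ; (inj₂ refl) q → below (IsStep.incl t (unflip-∋ q)) }
    ; old  = λ { (inj₁ refl) → ∋-predʳ γ o' b a above' ; (inj₂ refl) → above' }
    ; incl = λ {c} q → IsStep.excl s' (IsStep.incl s (IsStep.incl t q))
        (λ { (inj₁ refl) → IsStep.new t (inj₂ refl) (unflip-∋ q)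
           ; (inj₂ refl) → IsStep.new s (inj₂ refl) (IsStep.incl t (unflip-∋ q)) })
    ; excl = λ {c} q ¬p → IsStep.excl t (IsStep.excl s (IsStep.incl s' q)
        (λ { (inj₁ refl) → ¬p (inj₂ (cell-other o≢o' _ _))
           ; (inj₂ refl) → IsStep.new s' (inj₂ refl) (flip-∋ q) }))
        (λ { (inj₁ refl) → ¬p (inj₁ (cell-other o≢o' _ _))
           ; (inj₂ refl) → IsStep.new s' (inj₁ refl) (flip-∋ q) }) }
    where
    below : ¬ α ∋ cell o (suc a) b
    below = IsStep.new s (inj₁ refl)
    above' : γ ∋ cell o' b (suc a)
    above' = above-∋ s' b refl
    removed : ∃ λ δ → IsStep δ α (domino o a b)
    removed = removable α o a b (above-∋ s a refl)
      (λ p → below-∌ s' (flip-∋ (IsStep.incl s p)))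
      below
    δ = proj₁ removed
    t = proj₂ removed

  -- The two tilings of a 2 by 2 square. Over `δ`, the shapes `α` and `γ` contain the first domino
  -- of each tiling, which overlap in the inner corner; `β` contains the whole square.
  join-corner : ∀ {α δ γ} → IsStep δ α (domino o a b) → IsStep δ γ (domino o' b a) →
    ∃ λ β → IsStep α β (domino o (suc a) b) × IsStep γ β (domino o' (suc b) a)
  join-corner {α} {δ} {γ} t t' = β , s , record
    { new  = λ { (inj₁ refl) q → below-∌ t' q
               ; (inj₂ refl) q → below-∌ t' (∋-predʳ γ o' (suc b) a q) }
    ; old  = λ { (inj₁ refl) → flip-∋ (IsStep.incl s (IsStep.old t (inj₂ refl)))
               ; (inj₂ refl) → flip-∋ (IsStep.old s (inj₂ refl)) }
    ; incl = λ {c} q → incl' q (c ∈ᵈ? domino o' b a)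
    ; excl = λ {c} q ¬p → excl' q ¬p (c ∈ᵈ? domino o (suc a) b) (c ∈ᵈ? domino o a b) }
    where
    added : ∃ λ β → IsStep α β (domino o (suc a) b)
    added = addable α o (suc a) b (below-∌ t) (λ { _ refl → IsStep.old t (inj₂ refl) })
      λ { b' refl → unflip-∋ (IsStep.incl t (above-∋ t' b' refl)) }
    β = proj₁ added
    s = proj₂ added
    incl' : ∀ {c} → γ ∋ c → Dec (c ∈ᵈ domino o' b a) → β ∋ c
    incl' q (yes (inj₁ refl)) = flip-∋ (IsStep.incl s (IsStep.old t (inj₁ refl)))
    incl' q (yes (inj₂ refl)) = flip-∋ (IsStep.old s (inj₁ refl))
    incl' q (no ¬p) = IsStep.incl s (IsStep.incl t (IsStep.excl t' q ¬p))
    excl' : ∀ {c} → β ∋ c → ¬ c ∈ᵈ domino o' (suc b) a → Dec (c ∈ᵈ domino o (suc a) b) →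
      Dec (c ∈ᵈ domino o a b) → γ ∋ c
    excl' q ¬p (yes (inj₁ refl)) _ = unflip-∋ (IsStep.old t' (inj₂ refl))
    excl' q ¬p (yes (inj₂ refl)) _ = ⊥-elim (¬p (inj₂ (cell-other o≢o' _ _)))
    excl' q ¬p (no ¬r) (yes (inj₁ refl)) = unflip-∋ (IsStep.old t' (inj₁ refl))
    excl' q ¬p (no ¬r) (yes (inj₂ refl)) = ⊥-elim (¬p (inj₁ (cell-other o≢o' _ _)))
    excl' q ¬p (no ¬r) (no ¬r') = IsStep.incl t' (IsStep.excl t (IsStep.excl s q ¬r) ¬r')

-- The weighted domino addition and removal operators

evens : (Cell → ℕ) → Domino → ℕ
evens coord d = (if isEven (coord (first d)) then 1 else 0) + (if isEven (coord (second d)) then 1 else 0)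

verticals : Orientation → ℕ
verticals hor = 0
verticals ver = 1

w⁺ w⁻ : Domino → Mono
w⁺ d = + 1 ℤ.- + evens proj₁ d , + 1 ℤ.- + evens proj₂ d , verticals (Domino.orient d)
w⁻ d = ℤ.- (+ 1) ℤ.+ + evens proj₁ d , ℤ.- (+ 1) ℤ.+ + evens proj₂ d , verticals (Domino.orient d)

U D : Partition → Partition → WSet
U α β = record { Obj = Step α β ; wt = w⁺ ∘ dom }
D α β = record { Obj = Step β α ; wt = w⁻ ∘ dom }

Id : Partition → Partition → WSet
Id α β = record { Obj = α ≡ β ; wt = λ _ → 1ᴹ }

𝕔 𝕖 : WSet
𝕔 = record { Obj = Orientation ; wt = λ { hor → (+ 1 , + 0 , 0) ; ver → (+ 0 , + 1 , 1) } }
𝕖 = record { Obj = Orientation ; wt = λ { hor → (+ 0 , + 0 , 0) ; ver → (+ 0 , + 0 , 2) } }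

-- Along a domino exactly one of the two positions is even, so one exponent is 0. The other is 1 or
-- -1 by the parity of the line: the next line reverses it, and so does the passage from `w⁻` to
-- `w⁺`.
w⁻-shift : ∀ o a b b' → w⁻ (domino o a b') ≡ w⁺ (domino o (suc a) b)
w⁻-shift hor a b b' with isEven a | isEven b | isEven b'
... | true  | true  | true  = refl
... | true  | true  | false = refl
... | true  | false | true  = refl
... | true  | false | false = refl
... | false | true  | true  = refl
... | false | true  | false = refl
... | false | false | true  = refl
... | false | false | false = refl
w⁻-shift ver a b b' with isEven a | isEven b | isEven b'
... | true  | true  | true  = refl
... | true  | true  | false = refl
... | true  | false | true  = refl
... | true  | false | false = refl
... | false | true  | true  = refl
... | false | true  | false = refl
... | false | false | true  = refl
... | false | false | false = refl

w⁺-shift : ∀ o a b b' → w⁺ (domino o a b') ≡ w⁻ (domino o (suc a) b)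
w⁺-shift hor a b b' with isEven a | isEven b | isEven b'
... | true  | true  | true  = refl
... | true  | true  | false = refl
... | true  | false | true  = refl
... | true  | false | false = refl
... | false | true  | true  = refl
... | false | true  | false = refl
... | false | false | true  = refl
... | false | false | false = refl
w⁺-shift ver a b b' with isEven a | isEven b | isEven b'
... | true  | true  | true  = refl
... | true  | true  | false = refl
... | true  | false | true  = refl
... | true  | false | false = refl
... | false | true  | true  = refl
... | false | true  | false = refl
... | false | false | true  = refl
... | false | false | false = refl

w⁺-edge : ∀ o b → wt 𝕔 o ≡ w⁺ (domino o 0 b)
w⁺-edge hor b with isEven b
... | true  = refl
... | false = refl
w⁺-edge ver b with isEven b
... | true  = refl
... | false = refl

-- The exponents of x and y cancel and that of q^(1/2) doubles, so the place of the domino does not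
-- matter and 1 and q remain.
w⁺·w⁻ : ∀ d → w⁺ d · w⁻ d ≡ wt 𝕖 (Domino.orient d)
w⁺·w⁻ (domino hor a b) with isEven a | isEven b
... | true  | true  = refl
... | true  | false = refl
... | false | true  = refl
... | false | false = refl
w⁺·w⁻ (domino ver a b) with isEven a | isEven b
... | true  | true  = refl
... | true  | false = refl
... | false | true  = refl
... | false | false = refl

w⁺·w⁻-constant : ∀ o a b a' b' → w⁺ (domino o a b) · w⁻ (domino o a b) ≡ w⁺ (domino o a' b') · w⁻ (domino o a' b')
w⁺·w⁻-constant o a b a' b' = trans (w⁺·w⁻ (domino o a b)) (sym (w⁺·w⁻ (domino o a' b')))

-- The shift between lines leaves exactly two additions unmatched, the horizontal one in the first
-- row and the vertical one in the first column; they make up `𝕔`.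
additions≅removals : ∀ α → ΣW Partition (U α) ≅ ΣW Partition (D α) ⊕ 𝕔
additions≅removals α = fromRelation (λ x y → LineShift α (dom (proj₂ x)) (key y))
  total surjective
  (λ r r' → key-injective (LineShift-functional r r'))
  (λ r r' → step-injective (LineShift-injective r r'))
  (λ {x} {y} → weight {x} {y})
  where
  key : Obj (ΣW Partition (D α) ⊕ 𝕔) → Domino ⊎ Orientation
  key (inj₁ (_ , t)) = inj₁ (dom t)
  key (inj₂ o)       = inj₂ o

  total : ∀ x → Σ _ λ y → LineShift α (dom (proj₂ x)) (key y)
  total (_ , s@(mkStep (domino o zero b) _)) = inj₂ o , edge (pos≡len (step-spec s))
  total (_ , s@(mkStep (domino o (suc a) b) _)) with δ , t ← removable-above (step-spec s) =
    inj₁ (δ , mkStep _ t) , line (pos≡len (step-spec s)) refl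

  surjective : ∀ y → Σ _ λ x → LineShift α (dom (proj₂ x)) (key y)
  surjective (inj₂ o) with β , s ← addable-edge α o = (β , mkStep _ s) , edge refl
  surjective (inj₁ (_ , t@(mkStep (domino o a b) _))) with β , s ← addable-below (step-spec t) =
    (β , mkStep _ s) , line refl (pos≡len∸2 (step-spec t))

  key-injective : ∀ {y y'} → key y ≡ key y' → y ≡ y'
  key-injective {inj₂ o} {inj₂ .o} refl = refl
  key-injective {inj₁ (_ , t@(mkStep d _))} {inj₁ (_ , t'@(mkStep .d _))} refl
    with refl ← source-unique (step-spec t) (step-spec t') = refl

  step-injective : ∀ {x x' : Obj (ΣW Partition (U α))} → dom (proj₂ x) ≡ dom (proj₂ x') → x ≡ x'
  step-injective {_ , s@(mkStep d _)} {_ , s'@(mkStep .d _)} refl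
    with refl ← target-unique (step-spec s) (step-spec s') = refl

  weight : ∀ {x : Obj (ΣW Partition (U α))} {y} → LineShift α (dom (proj₂ x)) (key y) → wt (ΣW Partition (D α) ⊕ 𝕔) y ≡ w⁺ (dom (proj₂ x))
  weight {_ , mkStep (domino o a b) _} {inj₁ (_ , mkStep (domino o' a' b') _)} (line _ _) = w⁻-shift o a' b b'
  weight {_ , mkStep (domino o a b) _} {inj₂ _} (edge _) = w⁺-edge o b

-- Relative positions of two dominoes

cell≢ : ∀ o a b → cell o a b ≢ cell o a (suc b)
cell≢ o a b e = 1+n≢n (sym (proj₂ (cell-injective o e)))

height : Cell → ℕ
height (i , j) = i + j

height-second : ∀ d → height (second d) ≡ suc (height (first d))
height-second (domino hor a b) = +-suc (suc a) (suc b)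
height-second (domino ver a b) = refl

-- `height` increases by one along each domino, so two dominoes cannot occupy the same cells in
-- opposite order.
second⊈first : ∀ d d' → first d ≡ second d' → second d ≢ first d'
second⊈first d d' e e' = <⇒≢ (≤-trans (n≤1+n _) (≤-reflexive chain)) refl
  where
  chain : 2 + height (first d') ≡ height (first d')
  chain = trans (cong suc (trans (sym (height-second d')) (cong height (sym e))))
         (trans (sym (height-second d)) (cong height e'))

first≢second : ∀ d → first d ≢ second d
first≢second (domino o a b) = cell≢ o a b

first∈second∈⇒≡ : ∀ {d d'} → first d ∈ᵈ d' → second d ∈ᵈ d' → first d ≡ first d' × second d ≡ second d'
first∈second∈⇒≡ (inj₁ e) (inj₂ e') = e , e'
first∈second∈⇒≡ {d} {d'} (inj₁ e) (inj₁ e') = ⊥-elim (first≢second d (trans e (sym e')))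
first∈second∈⇒≡ {d} {d'} (inj₂ e) (inj₁ e') = ⊥-elim (second⊈first d d' e e')
first∈second∈⇒≡ {d} {d'} (inj₂ e) (inj₂ e') = ⊥-elim (first≢second d (trans e (sym e')))

-- Removable dominoes can only overlap at their outer ends: if `γ` lacks `first d`, it also lacks
-- its successor `second d`, so `d'` contains both and the second cells agree.
disjoint-second : ∀ {α β γ d d'} → IsStep α β d → IsStep γ β d' → second d ≢ second d' → Disjoint d d'
disjoint-second {β = β} s s' ne (inj₁ refl) q = ne (proj₂ (first∈second∈⇒≡ q (first⇒second s s' q)))
  where
  first⇒second : ∀ {α γ d d'} → IsStep α β d → IsStep γ β d' → first d ∈ᵈ d' → second d ∈ᵈ d'
  first⇒second {γ = γ} {d = d@(domino o a b)} {d'} s s' p with second d ∈ᵈ? d'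
  ... | yes q = q
  ... | no ¬q = ⊥-elim (IsStep.new s' p (∋-predʳ γ o a b (IsStep.excl s' (IsStep.old s (inj₂ refl)) ¬q)))
disjoint-second {d = d} {d'} s s' ne (inj₂ refl) (inj₂ e) = ne e
disjoint-second {d = d} {d'} s s' ne (inj₂ refl) (inj₁ e) =
  disjoint-second s' s (ne ∘ sym) (inj₁ refl) (inj₂ (sym e))

-- Dually, addable dominoes can only overlap at their inner ends, since a shape that contains the
-- second cell contains the first.
disjoint-first : ∀ {α δ γ d d'} → IsStep δ α d' → IsStep δ γ d → first d ≢ first d' → Disjoint d d'
disjoint-first {δ = δ} t t' ne (inj₂ refl) q = ne (proj₁ (first∈second∈⇒≡ (second⇒first t t' q) q))
  where
  second⇒first : ∀ {α γ d d'} → IsStep δ α d' → IsStep δ γ d → second d ∈ᵈ d' → first d ∈ᵈ d'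
  second⇒first {α = α} {d = d@(domino o a b)} {d'} t t' p with first d ∈ᵈ? d'
  ... | yes q = q
  ... | no ¬q = ⊥-elim (IsStep.new t' (inj₁ refl) (IsStep.excl t (∋-predʳ α o a b (IsStep.old t p)) ¬q))
disjoint-first t t' ne (inj₁ refl) (inj₁ e) = ne e
disjoint-first t t' ne (inj₁ refl) (inj₂ e) = disjoint-first t' t (ne ∘ sym) (inj₂ refl) (inj₁ (sym e))

data SecondView : Domino → Domino → Set where
  same  : ∀ {d} → SecondView d d
  cross : ∀ {o o' a b} → o ≢ o' → SecondView (domino o (suc a) b) (domino o' (suc b) a)
  apart : ∀ {d d'} → second d ≢ second d' → SecondView d d'

secondView : ∀ d d' → SecondView d d'
secondView d@(domino o a b) d'@(domino o' a' b') with second d ≟ᶜ second d' | o ≟ᵒ o'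
... | no ne | _        = apart ne
... | yes e | yes refl with refl , refl ← cell-injective o e = same
... | yes e | no o≢o'  with refl , refl ← cell-injective o' (trans (sym (cell-other o≢o' _ _)) e) = cross o≢o'

data FirstView : Domino → Domino → Set where
  same  : ∀ {d} → FirstView d d
  cross : ∀ {o o' a b} → o ≢ o' → FirstView (domino o a b) (domino o' b a)
  apart : ∀ {d d'} → first d ≢ first d' → FirstView d d'

firstView : ∀ d d' → FirstView d d'
firstView d@(domino o a b) d'@(domino o' a' b') with first d ≟ᶜ first d' | o ≟ᵒ o'
... | no ne | _        = apart ne
... | yes e | yes refl with refl , refl ← cell-injective o e = same
... | yes e | no o≢o'  with refl , refl ← cell-injective o' (trans (sym (cell-other o≢o' _ _)) e) = cross o≢o'

-- Adding d and then removing d' corresponds to removing d' and then adding d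
-- if they are disjoint; overlapping dominoes are shifted one step along the diagonal.
data Exchange (α : Partition) : Domino → Domino → (Domino × Domino) ⊎ Orientation → Set where
  same-line : ∀ {d t} → LineShift α d (inj₁ t) → Exchange α d d (inj₁ (t , t))
  same-edge : ∀ {d o} → LineShift α d (inj₂ o) → Exchange α d d (inj₂ o)
  cross     : ∀ {o o' a b} → o ≢ o' → Exchange α (domino o (suc a) b) (domino o' (suc b) a) (inj₁ (domino o a b , domino o' b a))
  apart     : ∀ {d d'} → Disjoint d d' → Exchange α d d' (inj₁ (d' , d))

Exchange-functional : ∀ {α d d' r r'} → Exchange α d d' r → Exchange α d d' r' → r ≡ r'
Exchange-functional (same-line l) (same-line l') with refl ← LineShift-functional l l' = refl
Exchange-functional (same-line l) (same-edge l') with () ← LineShift-functional l l'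
Exchange-functional (same-line l) (cross ne)     = ⊥-elim (ne refl)
Exchange-functional (same-line l) (apart disj)   = ⊥-elim (disj (inj₁ refl) (inj₁ refl))
Exchange-functional (same-edge l) (same-line l') with () ← LineShift-functional l l'
Exchange-functional (same-edge l) (same-edge l') with refl ← LineShift-functional l l' = refl
Exchange-functional (same-edge l) (cross ne)     = ⊥-elim (ne refl)
Exchange-functional (same-edge l) (apart disj)   = ⊥-elim (disj (inj₁ refl) (inj₁ refl))
Exchange-functional (cross ne)    (same-line l)  = ⊥-elim (ne refl)
Exchange-functional (cross ne)    (same-edge l)  = ⊥-elim (ne refl)
Exchange-functional (cross ne)    (cross _)      = refl
Exchange-functional (cross ne)    (apart disj)   = ⊥-elim (disj (inj₂ refl) (inj₂ (cell-other ne _ _)))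
Exchange-functional (apart disj)  (same-line l)  = ⊥-elim (disj (inj₁ refl) (inj₁ refl))
Exchange-functional (apart disj)  (same-edge l)  = ⊥-elim (disj (inj₁ refl) (inj₁ refl))
Exchange-functional (apart disj)  (cross ne)     = ⊥-elim (disj (inj₂ refl) (inj₂ (cell-other ne _ _)))
Exchange-functional (apart disj)  (apart _)      = refl

Exchange-injective : ∀ {α d₁ d₁' d₂ d₂' r} → Exchange α d₁ d₁' r → Exchange α d₂ d₂' r → d₁ ≡ d₂ × d₁' ≡ d₂'
Exchange-injective (same-line l) (same-line l') with refl ← LineShift-injective l l' = refl , refl
Exchange-injective (same-line l) (cross ne)     = ⊥-elim (ne refl)
Exchange-injective (same-line l) (apart disj)   = ⊥-elim (disj (inj₁ refl) (inj₁ refl))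
Exchange-injective (same-edge l) (same-edge l') with refl ← LineShift-injective l l' = refl , refl
Exchange-injective (cross ne)    (same-line l)  = ⊥-elim (ne refl)
Exchange-injective (cross ne)    (cross _)      = refl , refl
Exchange-injective (cross ne)    (apart disj)   = ⊥-elim (disj (inj₁ refl) (inj₁ (sym (cell-other ne _ _))))
Exchange-injective (apart disj)  (same-line l)  = ⊥-elim (disj (inj₁ refl) (inj₁ refl))
Exchange-injective (apart disj)  (cross ne)     = ⊥-elim (disj (inj₁ refl) (inj₁ (sym (cell-other ne _ _))))
Exchange-injective (apart disj)  (apart _)      = refl , refl

UD≅DU : ∀ α γ → ΣW Partition (λ β → U α β ⊗ D β γ) ≅ ΣW Partition (λ δ → D α δ ⊗ U δ γ) ⊕ (Id α γ ⊗ 𝕖)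
UD≅DU α γ = fromRelation R total surjective
  (λ r r' → key-injective (Exchange-functional r r'))
  (λ r r' → steps-injective (Exchange-injective r r'))
  (λ {x} {y} → weight {x} {y})
  where
  L = ΣW Partition (λ β → U α β ⊗ D β γ)
  M = ΣW Partition (λ δ → D α δ ⊗ U δ γ) ⊕ (Id α γ ⊗ 𝕖)

  key : Obj M → (Domino × Domino) ⊎ Orientation
  key (inj₁ (_ , t , t')) = inj₁ (dom t , dom t')
  key (inj₂ (_ , o))      = inj₂ o

  R : Obj L → Obj M → Set
  R (_ , s , s') y = Exchange α (dom s) (dom s') (key y)

  total : ∀ x → Σ (Obj M) (R x)
  total (_ , s@(mkStep d _) , s'@(mkStep d' _)) = go (step-spec s) (step-spec s') (secondView d d')
    where
    go : ∀ {β d d'} → IsStep α β d → IsStep γ β d' → SecondView d d' → Σ (Obj M) λ y → Exchange α d d' (key y)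
    go {d = domino o zero b} s s' same = inj₂ (source-unique s s' , o) , same-edge (edge (pos≡len s))
    go {d = domino o (suc a) b} s s' same
      with refl ← source-unique s s' | δ , t ← removable-above s =
      inj₁ (δ , mkStep _ t , mkStep _ t) , same-line (line (pos≡len s) refl)
    go s s' (cross ne) with δ , t , t' ← split-corner ne s s' =
      inj₁ (δ , mkStep _ t , mkStep _ t') , cross ne
    go s s' (apart ne) with δ , t , t' ← split-square s s' (disjoint-second s s' ne) =
      inj₁ (δ , mkStep _ t , mkStep _ t') , apart (disjoint-second s s' ne)

  surjective : ∀ y → Σ (Obj L) λ x → R x y
  surjective (inj₂ (refl , o)) with β , s ← addable-edge α o =
    (β , mkStep _ s , mkStep _ s) , same-edge (edge refl)
  surjective (inj₁ (_ , t@(mkStep d _) , t'@(mkStep d' _))) = go (step-spec t) (step-spec t') (firstView d d')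
    where
    go : ∀ {δ d d'} → IsStep δ α d → IsStep δ γ d' → FirstView d d' →
      Σ (Obj L) λ (_ , s , s') → Exchange α (dom s) (dom s') (inj₁ (d , d'))
    go t t' same with refl ← target-unique t t' | β , s ← addable-below t =
      (β , mkStep _ s , mkStep _ s) , same-line (line refl (pos≡len∸2 t))
    go t t' (cross ne) with β , s , s' ← join-corner ne t t' = (β , mkStep _ s , mkStep _ s') , cross ne
    go t t' (apart ne) with β , s , s' ← join-square t t' (disjoint-first t t' (ne ∘ sym)) =
      (β , mkStep _ s , mkStep _ s') , apart (disjoint-first t t' (ne ∘ sym))

  key-injective : ∀ {y y'} → key y ≡ key y' → y ≡ y'
  key-injective {inj₂ (e , o)} {inj₂ (e' , .o)} refl = cong (λ e → inj₂ (e , o)) (uip e e')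
  key-injective {inj₁ (_ , t@(mkStep d _) , mkStep d' _)} {inj₁ (_ , t'@(mkStep .d _) , mkStep .d' _)} refl
    with refl ← source-unique (step-spec t) (step-spec t') = refl

  steps-injective : ∀ {x x' : Obj L} →
    dom (proj₁ (proj₂ x)) ≡ dom (proj₁ (proj₂ x')) × dom (proj₂ (proj₂ x)) ≡ dom (proj₂ (proj₂ x')) → x ≡ x'
  steps-injective {_ , s@(mkStep d _) , mkStep d' _} {_ , s'@(mkStep .d _) , mkStep .d' _} (refl , refl)
    with refl ← target-unique (step-spec s) (step-spec s') = refl

  weight : ∀ {x y} → R x y → wt M y ≡ wt L x
  weight {_ , mkStep d _ , mkStep d' _} {inj₁ (_ , mkStep t _ , mkStep t' _)} r = go r
    where
    go : ∀ {d d' t t'} → Exchange α d d' (inj₁ (t , t')) → w⁻ t · w⁺ t' ≡ w⁺ d · w⁻ d'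
    go {domino o _ b} {t = domino _ a b'} (same-line (line _ _)) = trans (·-comm (w⁻ (domino o a b')) (w⁺ (domino o a b'))) (w⁺·w⁻-constant o a b' (suc a) b)
    go (cross {o} {o'} {a} {b} _) = cong₂ _·_ (w⁻-shift o a b b) (w⁺-shift o' b a a)
    go {d} {d'} (apart _) = ·-comm (w⁻ d') (w⁺ d)
  weight {_ , mkStep d _ , mkStep d' _} {inj₂ (_ , o)} r = go r
    where
    go : ∀ {d d'} → Exchange α d d' (inj₂ o) → 1ᴹ · wt 𝕖 o ≡ w⁺ d · w⁻ d'
    go {d} (same-edge (edge _)) = trans (·-identityˡ (wt 𝕖 o)) (sym (w⁺·w⁻ d))

-- Lengths of chains of domino removals

data Descent : ℕ → Partition → Partition → Set where
  []  : ∀ {α} → Descent 0 α α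
  _∷_ : ∀ {n α β γ} → Step β α → Descent n β γ → Descent (suc n) α γ

Terminal : Partition → Set
Terminal γ = ∀ δ → ¬ Step δ γ

confluence : ∀ {β γ α} → Step β α → Step γ α → β ≡ γ ⊎ ∃ λ δ → Step δ β × Step δ γ
confluence s@(mkStep d _) s'@(mkStep d' _) = go (step-spec s) (step-spec s') (secondView d d')
  where
  go : ∀ {β γ α d d'} → IsStep β α d → IsStep γ α d' → SecondView d d' → β ≡ γ ⊎ ∃ λ δ → Step δ β × Step δ γ
  go s s' same       = inj₁ (source-unique s s')
  go s s' (cross ne) with δ , t , t' ← split-corner ne s s' = inj₂ (δ , mkStep _ t , mkStep _ t')
  go s s' (apart ne) with δ , t , t' ← split-square s s' (disjoint-second s s' ne) =
    inj₂ (δ , mkStep _ t , mkStep _ t')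

-- Both sides of the diamond in `confluence` have length one, so pushing `t` through the chain
-- neither lengthens nor shortens it: any first removal starts a chain to `γ` of the same total
-- length.
descent-after : ∀ {k α β γ} → Terminal γ → Descent (suc k) α γ → Step β α → Descent k β γ
descent-after         term (s ∷ p)        t with confluence s t
descent-after         term (s ∷ p)        t | inj₁ refl            = p
-- Here `s` already ends in `γ`, from which the diamond would remove one more domino.
descent-after {zero}  term (s ∷ [])       t | inj₂ (δ , u , u')    = ⊥-elim (term δ u)
descent-after {suc k} term (s ∷ p)        t | inj₂ (δ , u , u')    = u' ∷ descent-after term p u

descent-bound : ∀ {j k α μ γ} → Terminal γ → Descent k α γ → Descent j α μ → j ≤ k
descent-bound             term p []      = z≤n
descent-bound {k = zero}  term [] (s ∷ _) = ⊥-elim (term _ s)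
descent-bound {k = suc k} term p (s ∷ q) = s≤s (descent-bound term (descent-after term p s) q)

-- Domino tableaux as chains of domino additions

∈-bfilter⁺ : ∀ {A : Set} (p : A → Bool) {x} xs → x ∈ xs → T (p x) → x ∈ bfilter p xs
∈-bfilter⁺ p (y ∷ ys) x∈ px with p y in eq
∈-bfilter⁺ p (y ∷ ys) (here refl) px | true  = here refl
∈-bfilter⁺ p (y ∷ ys) (there x∈)  px | true  = there (∈-bfilter⁺ p ys x∈ px)
∈-bfilter⁺ p (y ∷ ys) (here refl) px | false = ⊥-elim (subst T eq px)
∈-bfilter⁺ p (y ∷ ys) (there x∈)  px | false = ∈-bfilter⁺ p ys x∈ px

∈-bfilter⁻ : ∀ {A : Set} (p : A → Bool) {x} xs → x ∈ bfilter p xs → x ∈ xs × T (p x)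
∈-bfilter⁻ p (y ∷ ys) x∈ with p y in eq
∈-bfilter⁻ p (y ∷ ys) (here refl) | true  = here refl , subst T (sym eq) tt
∈-bfilter⁻ p (y ∷ ys) (there x∈)  | true  = let q , r = ∈-bfilter⁻ p ys x∈ in there q , r
∈-bfilter⁻ p (y ∷ ys) x∈          | false = let q , r = ∈-bfilter⁻ p ys x∈ in there q , r

bfilter-Unique : ∀ {A : Set} (p : A → Bool) xs → Unique xs → Unique (bfilter p xs)
bfilter-Unique p []       []       = []
bfilter-Unique p (x ∷ xs) (u ∷ us) with p x
... | true  = All.tabulate (λ y∈ → All.lookup u (proj₁ (∈-bfilter⁻ p xs y∈))) ∷ bfilter-Unique p xs us
... | false = bfilter-Unique p xs us

count-∷ : ∀ {A : Set} (p : A → Bool) x xs → count p (x ∷ xs) ≡ (if p x then 1 else 0) + count p xs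
count-∷ p x xs with p x
... | true  = refl
... | false = refl

count-↭ : ∀ {A : Set} (p : A → Bool) {xs ys} → xs ↭ ys → count p xs ≡ count p ys
count-↭ p ↭-refl = refl
count-↭ p (prep {xs} {ys} x r) = trans (count-∷ p x xs)
  (trans (cong (_+_ (if p x then 1 else 0)) (count-↭ p r)) (sym (count-∷ p x ys)))
count-↭ p (↭-trans r s) = trans (count-↭ p r) (count-↭ p s)
count-↭ p (swap {xs} {ys} x y r) with p x | p y
... | true  | true  = cong (suc ∘ suc) (count-↭ p r)
... | true  | false = cong suc (count-↭ p r)
... | false | true  = cong suc (count-↭ p r)
... | false | false = count-↭ p r

T-not⁺ : ∀ {b} → ¬ T b → T (not b)
T-not⁺ {true}  ¬t = ¬t tt
T-not⁺ {false} ¬t = tt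

T-not⁻ : ∀ {b} → T (not b) → ¬ T b
T-not⁻ {false} _ ()

T-∧⁻ : ∀ {x y} → T (x ∧ y) → T x × T y
T-∧⁻ = Equivalence.to T-∧

T-∧⁺ : ∀ {x y} → T x → T y → T (x ∧ y)
T-∧⁺ p q = Equivalence.from T-∧ (p , q)

rowLen>0⇒∈ : ∀ k rs {a b} → b < rowLen rs (suc a) → (k + a , suc b) ∈ cellsFrom k rs
rowLen>0⇒∈ k []       {a} ()
rowLen>0⇒∈ k (r ∷ rs) {zero} {b} p rewrite +-identityʳ k =
  ∈-++⁺ˡ (∈-map⁺ (k ,_) (∈-map⁺ suc (∈-upTo⁺ p)))
rowLen>0⇒∈ k (r ∷ rs) {suc a} {b} p rewrite +-suc k a =
  ∈-++⁺ʳ (map (k ,_) (range1 r)) (rowLen>0⇒∈ (suc k) rs p)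

∈-cellsFrom⁻ : ∀ k rs {c} → c ∈ cellsFrom k rs →
  ∃ λ a → ∃ λ b → c ≡ (k + a , suc b) × b < rowLen rs (suc a)
∈-cellsFrom⁻ k (r ∷ rs) c∈ with ∈-++⁻ (map (k ,_) (range1 r)) c∈
... | inj₁ p with _ , q , refl ← ∈-map⁻ (k ,_) p with b , q' , refl ← ∈-map⁻ suc q =
  0 , b , cong (_, suc b) (sym (+-identityʳ k)) , ∈-upTo⁻ q'
... | inj₂ p with a , b , refl , q ← ∈-cellsFrom⁻ (suc k) rs p =
  suc a , b , cong (_, suc b) (sym (+-suc k a)) , q

cellsFrom-Unique : ∀ k rs → Unique (cellsFrom k rs)
cellsFrom-Unique k []       = []
cellsFrom-Unique k (r ∷ rs) = Uniqueₚ.++⁺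
  (Uniqueₚ.map⁺ (cong proj₂) (Uniqueₚ.map⁺ suc-injective (Uniqueₚ.upTo⁺ r)))
  (cellsFrom-Unique (suc k) rs) λ (p , q) → disjoint p q
  where
  disjoint : ∀ {c} → c ∈ map (k ,_) (range1 r) → ¬ c ∈ cellsFrom (suc k) rs
  disjoint p q with _ , _ , refl ← ∈-map⁻ (k ,_) p with a , _ , e , _ ← ∈-cellsFrom⁻ (suc k) rs q =
    m≢1+m+n k (cong proj₁ e)

∋⇒∈cells : ∀ α {c} → α ∋ c → c ∈ cells α
∋⇒∈cells α p with ∋⇒Bounded α p
... | bounded _ _ = rowLen>0⇒∈ 1 (parts α) (∋⇒<rowLen α p)

∈cells⇒∋ : ∀ α {c} → c ∈ cells α → α ∋ c
∈cells⇒∋ α p with a , b , refl , q ← ∈-cellsFrom⁻ 1 (parts α) p = <rowLen⇒∋ α q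

∈-skewCells⁺ : ∀ {λ' α c} → λ' ∋ c → ¬ α ∋ c → c ∈ skewCells λ' α
∈-skewCells⁺ {λ'} p ¬q = ∈-bfilter⁺ _ (cells λ') (∋⇒∈cells λ' p) (T-not⁺ (¬q ∘ ∋-intro))

∈-skewCells⁻ : ∀ {λ' α c} → c ∈ skewCells λ' α → λ' ∋ c × ¬ α ∋ c
∈-skewCells⁻ {λ'} p with q , r ← ∈-bfilter⁻ _ (cells λ') p = ∈cells⇒∋ λ' q , T-not⁻ r ∘ ∋-elim

skewCells-Unique : ∀ λ' α → Unique (skewCells λ' α)
skewCells-Unique λ' α = bfilter-Unique _ (cells λ') (cellsFrom-Unique 1 (parts λ'))

⊆ᵇ⁺ : ∀ {α λ'} → (∀ {c} → α ∋ c → λ' ∋ c) → T (α ⊆ᵇ λ')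
⊆ᵇ⁺ {α} f = Allₚ.all⁻ _ (All.tabulate (∋-elim ∘ f ∘ ∈cells⇒∋ α))

⊆ᵇ⁻ : ∀ {α λ'} → T (α ⊆ᵇ λ') → ∀ {c} → α ∋ c → λ' ∋ c
⊆ᵇ⁻ {α} t p = ∋-intro (All.lookup (Allₚ.all⁺ _ (cells α) t) (∋⇒∈cells α p))

=ᶜ⇒≡ : ∀ c d → T (c =ᶜ d) → c ≡ d
=ᶜ⇒≡ (i , j) (i' , j') t with p , q ← T-∧⁻ t = cong₂ _,_ (≡ᵇ⇒≡ i i' p) (≡ᵇ⇒≡ j j' q)

≡⇒=ᶜ : ∀ c d → c ≡ d → T (c =ᶜ d)
≡⇒=ᶜ (i , j) .(i , j) refl = T-∧⁺ (≡⇒≡ᵇ i i refl) (≡⇒≡ᵇ j j refl)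

∈ᵇ⁺ : ∀ {c cs} → c ∈ cs → T (c ∈ᵇ cs)
∈ᵇ⁺ {c} = Anyₚ.any⁺ _ ∘ Any.map (≡⇒=ᶜ c _)

∈ᵇ⁻ : ∀ {c cs} → T (c ∈ᵇ cs) → c ∈ cs
∈ᵇ⁻ {c} {cs} = Any.map (=ᶜ⇒≡ c _) ∘ Anyₚ.any⁻ _ cs

distinct⇒Unique : ∀ cs → T (distinct cs) → Unique cs
distinct⇒Unique []       _ = []
distinct⇒Unique (c ∷ cs) t with p , q ← T-∧⁻ t =
  All.tabulate (λ x∈ e → T-not⁻ p (∈ᵇ⁺ (subst (_∈ cs) (sym e) x∈))) ∷ distinct⇒Unique cs q

Unique⇒distinct : ∀ {cs} → Unique cs → T (distinct cs)
Unique⇒distinct []       = tt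
Unique⇒distinct (u ∷ us) = T-∧⁺ (T-not⁺ λ t → All.lookup u (∈ᵇ⁻ t) refl) (Unique⇒distinct us)

Increasing : List Cell → Set
Increasing = AllPairs (λ c d → T (notBefore c d))

increasing⁻ : ∀ cs → T (increasing cs) → Increasing cs
increasing⁻ []       _ = []
increasing⁻ (c ∷ cs) t with p , q ← T-∧⁻ t = Allₚ.all⁺ _ cs p ∷ increasing⁻ cs q

increasing⁺ : ∀ {cs} → Increasing cs → T (increasing cs)
increasing⁺ []       = tt
increasing⁺ (p ∷ ps) = T-∧⁺ (Allₚ.all⁻ _ p) (increasing⁺ ps)

-- The Boolean conditions on a tableau as facts about single cells, so that the first domino can be
-- split off field by field.
record IsFilling (α λ' : Partition) (o : List Cell) : Set where
  field
    incl       : ∀ {c} → α ∋ c → λ' ∋ c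
    sound      : ∀ {c} → c ∈ o → λ' ∋ c × ¬ α ∋ c
    complete   : ∀ {c} → λ' ∋ c → ¬ α ∋ c → c ∈ o
    unique     : Unique o
    increases  : Increasing o
    pairs      : T (dominoPairs o)

isSDT⇒IsFilling : ∀ {α λ'} o → T (α ⊆ᵇ λ') → T (isSDT λ' α o) → IsFilling α λ' o
isSDT⇒IsFilling {α} {λ'} o t v
  with v₁ , v ← T-∧⁻ {distinct o} v with v₂ , v ← T-∧⁻ {all (_∈ᵇ skewCells λ' α) o} v
  with v₃ , v ← T-∧⁻ {all (_∈ᵇ o) (skewCells λ' α)} v with v₄ , v₅ ← T-∧⁻ {increasing o} v = record
  { incl      = ⊆ᵇ⁻ t
  ; sound     = λ p → ∈-skewCells⁻ (∈ᵇ⁻ (All.lookup (Allₚ.all⁺ _ o v₂) p))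
  ; complete  = λ p ¬q → ∈ᵇ⁻ (All.lookup (Allₚ.all⁺ _ (skewCells λ' α) v₃) (∈-skewCells⁺ p ¬q))
  ; unique    = distinct⇒Unique o v₁
  ; increases = increasing⁻ o v₄
  ; pairs     = v₅ }

IsFilling⇒isSDT : ∀ {α λ' o} → IsFilling α λ' o → T (isSDT λ' α o)
IsFilling⇒isSDT {α} {λ'} {o} f =
  T-∧⁺ (Unique⇒distinct unique)
  (T-∧⁺ (Allₚ.all⁻ _ (All.tabulate (λ p → let q , r = sound p in ∈ᵇ⁺ (∈-skewCells⁺ q r))))
  (T-∧⁺ (Allₚ.all⁻ _ (All.tabulate (λ p → let q , r = ∈-skewCells⁻ {λ'} {α} p in ∈ᵇ⁺ (complete q r))))
  (T-∧⁺ (increasing⁺ increases) pairs)))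
  where open IsFilling f

-- Two duplicate-free lists with the same members are permutations of each other. This carries size
-- and even-cell counts, defined on `skewCells`, over to the order of the tableau.
filling-↭ : ∀ {α λ' o} → IsFilling α λ' o → skewCells λ' α ↭ o
filling-↭ {α} {λ'} f = ∼bag⇒↭ (unique∧set⇒bag (skewCells-Unique λ' α) unique
  (mk⇔ (λ p → let q , r = ∈-skewCells⁻ {λ'} {α} p in complete q r)
       (λ p → let q , r = sound p in ∈-skewCells⁺ q r)))
  where open IsFilling f

notBefore⁺ : ∀ {i j i' j'} → (i ≡ i' → j ≤ j') → (j ≡ j' → i ≤ i') → T (notBefore (i , j) (i' , j'))
notBefore⁺ {i} {j} {i'} {j'} f g = T-∧⁺
  (T-not⁺ λ t → let p , q = T-∧⁻ {i ≡ᵇ i'} t in <⇒≱ (<ᵇ⇒< j' j q) (f (≡ᵇ⇒≡ i i' p)))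
  (T-not⁺ λ t → let p , q = T-∧⁻ {j ≡ᵇ j'} t in <⇒≱ (<ᵇ⇒< i' i q) (g (≡ᵇ⇒≡ j j' p)))

notBefore⁻ : ∀ {i j i' j'} → T (notBefore (i , j) (i' , j')) → (i ≡ i' → j ≤ j') × (j ≡ j' → i ≤ i')
notBefore⁻ {i} {j} {i'} {j'} t with p , q ← T-∧⁻ {not ((i ≡ᵇ i') ∧ (j' <ᵇ j))} t =
  (λ e → ≮⇒≥ λ l → T-not⁻ p (T-∧⁺ (≡⇒≡ᵇ i i' e) (<⇒<ᵇ l))) ,
  (λ e → ≮⇒≥ λ l → T-not⁻ q (T-∧⁺ (≡⇒≡ᵇ j j' e) (<⇒<ᵇ l)))

¬notBefore-pred : ∀ o a b → ¬ T (notBefore (cell o (suc a) b) (cell o a b))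
¬notBefore-pred hor a b t = <-irrefl refl (proj₂ (notBefore⁻ {suc (suc a)} {suc b} t) refl)
¬notBefore-pred ver a b t = <-irrefl refl (proj₁ (notBefore⁻ {suc b} {suc (suc a)} t) refl)

¬notBefore-predʳ : ∀ o a b → ¬ T (notBefore (cell o a (suc b)) (cell o a b))
¬notBefore-predʳ hor a b = ¬notBefore-pred ver b a
¬notBefore-predʳ ver a b = ¬notBefore-pred hor b a

-- A cell to the left of `c` in its row, or above it in its column, lies in `β` together with `c`.
notBefore-outside : ∀ {β λ' c x} → β ∋ c → λ' ∋ x → ¬ β ∋ x → T (notBefore c x)
notBefore-outside {β} {λ'} p q ¬r with ∋⇒Bounded β p | ∋⇒Bounded λ' q
... | bounded {a} {b} _ _ | bounded {a'} {b'} _ _ = notBefore⁺ {suc a} {suc b} {suc a'} {suc b'}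
  (λ { refl → ≮⇒≥ λ { (s≤s l) → ¬r (left b' b l p) } })
  (λ { refl → ≮⇒≥ λ { (s≤s l) → ¬r (up a' a l p) } })
  where
  left : ∀ b' b → b' < b → β ∋ (suc a , suc b) → β ∋ (suc a , suc b')
  left b' b l p = <rowLen⇒∋ β (<-trans l (∋⇒<rowLen β p))
  up : ∀ a' a → a' < a → ∀ {b} → β ∋ (suc a , suc b) → β ∋ (suc a' , suc b)
  up a' (suc a) l p with m≤n⇒m<n∨m≡n l
  ... | inj₁ (s≤s l') = up a' a l' (∋-pred β hor a _ p)
  ... | inj₂ refl     = ∋-pred β hor a _ p

adjacent-domino : ∀ d → T (adjacent (first d) (second d))
adjacent-domino (domino hor a b) = Equivalence.from T-∨ (inj₁ (T-∧⁺ {a ≡ᵇ a} (≡⇒≡ᵇ a a refl) (Equivalence.from T-∨ (inj₁ (≡⇒≡ᵇ b b refl)))))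
adjacent-domino (domino ver a b) = Equivalence.from (T-∨ {(b ≡ᵇ suc b) ∧ _}) (inj₂ (T-∧⁺ {a ≡ᵇ a} (≡⇒≡ᵇ a a refl) (Equivalence.from T-∨ (inj₁ (≡⇒≡ᵇ b b refl)))))

adjacent⇒domino : ∀ {α c d} → α ∋ c → α ∋ d → T (adjacent c d) →
  ∃ λ D → (first D ≡ c × second D ≡ d) ⊎ (first D ≡ d × second D ≡ c)
adjacent⇒domino {α} {c} {d} p q t with ∋⇒Bounded α p | ∋⇒Bounded α q
... | bounded {a} {b} _ _ | bounded {a'} {b'} _ _ with Equivalence.to (T-∨ {(a ≡ᵇ a') ∧ _}) t
adjacent⇒domino p q t | bounded {a} {b} _ _ | bounded {a'} {b'} _ _ | inj₁ u
  with e , u' ← T-∧⁻ {a ≡ᵇ a'} u with refl ← ≡ᵇ⇒≡ a a' e with Equivalence.to (T-∨ {suc b ≡ᵇ b'}) u'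
... | inj₁ e' with refl ← ≡ᵇ⇒≡ (suc b) b' e' = domino hor a b  , inj₁ (refl , refl)
... | inj₂ e' with refl ← ≡ᵇ⇒≡ (suc b') b e' = domino hor a b' , inj₂ (refl , refl)
adjacent⇒domino p q t | bounded {a} {b} _ _ | bounded {a'} {b'} _ _ | inj₂ u
  with e , u' ← T-∧⁻ {b ≡ᵇ b'} u with refl ← ≡ᵇ⇒≡ b b' e with Equivalence.to (T-∨ {suc a ≡ᵇ a'}) u'
... | inj₁ e' with refl ← ≡ᵇ⇒≡ (suc a) a' e' = domino ver b a  , inj₁ (refl , refl)
... | inj₂ e' with refl ← ≡ᵇ⇒≡ (suc a') a e' = domino ver b a' , inj₂ (refl , refl)

data Path : ℕ → Partition → Partition → Set where
  []  : ∀ {α} → Path 0 α α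
  _∷_ : ∀ {n α β λ'} → Step α β → Path n β λ' → Path (suc n) α λ'

toOrder : ∀ {n α λ'} → Path n α λ' → List Cell
toOrder []      = []
toOrder (s ∷ p) = first (dom s) ∷ second (dom s) ∷ toOrder p

length-toOrder : ∀ {n α λ'} (p : Path n α λ') → length (toOrder p) ≡ 2 * n
length-toOrder             []      = refl
length-toOrder {n = suc n} (s ∷ p) = trans (cong (suc ∘ suc) (length-toOrder p)) (sym (*-suc 2 n))

filling-∷ : ∀ {α β λ' d o} → IsStep α β d → IsFilling β λ' o → IsFilling α λ' (first d ∷ second d ∷ o)
filling-∷ {α} {β} {λ'} {d@(domino _ a b)} {o} s f = record
  { incl      = F.incl ∘ S.incl
  ; sound     = λ { (here refl)         → F.incl (S.old (inj₁ refl)) , S.new (inj₁ refl)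
                  ; (there (here refl)) → F.incl (S.old (inj₂ refl)) , S.new (inj₂ refl)
                  ; (there (there p))   → proj₁ (F.sound p) , proj₂ (F.sound p) ∘ S.incl }
  ; complete  = λ {c} p ¬q → complete p ¬q (c ∈ᵈ? d)
  ; unique    = (first≢second d ∷ outside (inj₁ refl)) ∷ outside (inj₂ refl) ∷ F.unique
  ; increases = (first-second d ∷ after (inj₁ refl)) ∷ after (inj₂ refl) ∷ F.increases
  ; pairs     = T-∧⁺ (adjacent-domino d) F.pairs }
  where
  module S = IsStep s
  module F = IsFilling f
  complete : ∀ {c} → λ' ∋ c → ¬ α ∋ c → Dec (c ∈ᵈ d) → c ∈ first d ∷ second d ∷ o
  complete p ¬q (yes (inj₁ e)) = here e
  complete p ¬q (yes (inj₂ e)) = there (here e)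
  complete p ¬q (no ¬r)        = there (there (F.complete p (λ q → ¬q (S.excl q ¬r))))
  outside : ∀ {c} → c ∈ᵈ d → All (c ≢_) o
  outside p = All.tabulate λ { q refl → proj₂ (F.sound q) (S.old p) }
  after : ∀ {c} → c ∈ᵈ d → All (λ x → T (notBefore c x)) o
  after p = All.tabulate λ q → notBefore-outside (S.old p) (proj₁ (F.sound q)) (proj₂ (F.sound q))
  first-second : ∀ d → T (notBefore (first d) (second d))
  first-second (domino hor a b) = notBefore⁺ {suc a} {suc b} (λ _ → n≤1+n _) (λ _ → ≤-refl)
  first-second (domino ver a b) = notBefore⁺ {suc b} {suc a} (λ _ → ≤-refl) (λ _ → n≤1+n _)

-- `c` must be the inner cell of the domino, since the other order decreases along it. A cell of
-- `λ'` just above or left of the domino and outside `α` would occur later in the list, against the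
-- increase; so the domino fits onto `α`.
filling-uncons : ∀ {α λ' c d o} → IsFilling α λ' (c ∷ d ∷ o) →
  ∃ λ D → first D ≡ c × second D ≡ d × ∃ λ β → IsStep α β D × IsFilling β λ' o
filling-uncons {α} {λ'} {c} {d} {o} f
  with (_ ∷ c≢o) ∷ d≢o ∷ o-unique ← IsFilling.unique f
     | (c<d ∷ c<o) ∷ d<o ∷ o-increases ← IsFilling.increases f
     | c~d , o-pairs ← T-∧⁻ {adjacent c d} (IsFilling.pairs f)
  with adjacent⇒domino (proj₁ (IsFilling.sound f (here refl))) (proj₁ (IsFilling.sound f (there (here refl)))) c~d
... | D@(domino O a b) , inj₂ (refl , refl) = ⊥-elim (¬notBefore-predʳ O a b c<d)
... | D@(domino O a b) , inj₁ (refl , refl) = D , refl , refl , β , s , record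
  { incl      = λ {x} p → incl' p (x ∈ᵈ? D)
  ; sound     = λ {x} p → proj₁ (F.sound (there (there p))) ,
      λ q → proj₂ (F.sound (there (there p))) (S.excl q
        λ { (inj₁ refl) → All.lookup c≢o p refl ; (inj₂ refl) → All.lookup d≢o p refl })
  ; complete  = λ p ¬q → rest (F.complete p (¬q ∘ S.incl)) ¬q
  ; unique    = o-unique
  ; increases = o-increases
  ; pairs     = o-pairs }
  where
  module F = IsFilling f
  above : ∀ a' → a ≡ suc a' → α ∋ cell O a' (suc b)
  above a' refl with α ∋? cell O a' (suc b)
  ... | yes p = p
  ... | no ¬p with F.complete (∋-pred λ' O a' (suc b) (proj₁ (F.sound (there (here refl))))) ¬p
  ...   | here e           = ⊥-elim (1+n≢n (sym (proj₁ (cell-injective O e))))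
  ...   | there (here e)   = ⊥-elim (1+n≢n (sym (proj₁ (cell-injective O e))))
  ...   | there (there x∈) = ⊥-elim (¬notBefore-pred O a' (suc b) (All.lookup d<o x∈))
  left : ∀ b' → b ≡ suc b' → α ∋ cell O a b'
  left b' refl with α ∋? cell O a b'
  ... | yes p = p
  ... | no ¬p with F.complete (∋-predʳ λ' O a b' (proj₁ (F.sound (here refl)))) ¬p
  ...   | here e           = ⊥-elim (1+n≢n (sym (proj₂ (cell-injective O e))))
  ...   | there x∈         = ⊥-elim (¬notBefore-predʳ O a b' (All.lookup (c<d ∷ c<o) x∈))
  added : ∃ λ β → IsStep α β D
  added = addable α O a b (proj₂ (F.sound (here refl))) above left
  β = proj₁ added
  s = proj₂ added
  module S = IsStep s
  incl' : ∀ {x} → β ∋ x → Dec (x ∈ᵈ D) → λ' ∋ x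
  incl' p (yes (inj₁ refl)) = proj₁ (F.sound (here refl))
  incl' p (yes (inj₂ refl)) = proj₁ (F.sound (there (here refl)))
  incl' p (no ¬q) = F.incl (S.excl p ¬q)
  rest : ∀ {x} → x ∈ first D ∷ second D ∷ o → ¬ β ∋ x → x ∈ o
  rest (here refl)         ¬q = ⊥-elim (¬q (S.old (inj₁ refl)))
  rest (there (here refl)) ¬q = ⊥-elim (¬q (S.old (inj₂ refl)))
  rest (there (there x∈))  ¬q = x∈

path-filling : ∀ {n α λ'} (p : Path n α λ') → IsFilling α λ' (toOrder p)
path-filling []      = record
  { incl = id ; sound = λ () ; complete = λ p ¬p → ⊥-elim (¬p p) ; unique = [] ; increases = [] ; pairs = tt }
path-filling (s ∷ p) = filling-∷ (step-spec s) (path-filling p)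

empty-filling : ∀ {α λ'} → IsFilling α λ' [] → α ≡ λ'
empty-filling {α} {λ'} f = Partition-ext incl outside
  where
  open IsFilling f
  outside : ∀ {c} → λ' ∋ c → α ∋ c
  outside {c} p with α ∋? c
  ... | yes q = q
  ... | no ¬q with () ← complete p ¬q

fromFilling : ∀ n {α λ' o} → IsFilling α λ' o → length o ≡ 2 * n → Σ (Path n α λ') λ p → toOrder p ≡ o
fromFilling zero {o = []} f _ with refl ← empty-filling f = [] , refl
fromFilling (suc n) {o = o} f e = go o f (trans e (*-suc 2 n))
  where
  go : ∀ {α λ'} o → IsFilling α λ' o → length o ≡ 2 + 2 * n → Σ (Path (suc n) α λ') λ p → toOrder p ≡ o
  go (c ∷ d ∷ o) f e
    with D , refl , refl , β , s , f' ← filling-uncons f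
    with p , refl ← fromFilling n f' (suc-injective (suc-injective e)) = mkStep D s ∷ p , refl

domino-≡ : ∀ {d d'} → first d ≡ first d' → second d ≡ second d' → d ≡ d'
domino-≡ {domino hor a b} {domino hor a' b'} refl refl = refl
domino-≡ {domino ver a b} {domino ver a' b'} refl refl = refl
domino-≡ {domino hor a b} {domino ver a' b'} refl ()
domino-≡ {domino ver a b} {domino hor a' b'} refl ()

toOrder-injective : ∀ {n α λ'} (p q : Path n α λ') → toOrder p ≡ toOrder q → p ≡ q
toOrder-injective []      []       _ = refl
toOrder-injective (s ∷ p) (s' ∷ q) e
  with e₁ , e' ← ∷-injective e with e₂ , e₃ ← ∷-injective e' = go s s' p q (domino-≡ e₁ e₂) e₃
  where
  go : ∀ {n α β β' λ'} (s : Step α β) (s' : Step α β') (p : Path n β λ') (q : Path n β' λ') →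
    dom s ≡ dom s' → toOrder p ≡ toOrder q → _≡_ {A = Path (suc n) α λ'} (s ∷ p) (s' ∷ q)
  go s@(mkStep d _) s'@(mkStep .d _) p q refl e
    with refl ← target-unique (step-spec s) (step-spec s') = cong (s ∷_) (toOrder-injective p q e)

-- Generating functions of chains

Tableaux : Partition → Partition → ℕ → Set
Tableaux α λ' n = T (α ⊆ᵇ λ') × (skewSize λ' α ≡ 2 * n) × SDT λ' α

tableau-filling : ∀ n {α λ'} (t : Tableaux α λ' n) → IsFilling α λ' (order (proj₂ (proj₂ t)))
tableau-filling n (t , _ , mkSDT o v) = isSDT⇒IsFilling o t v

tableau-path : ∀ n {α λ'} (t : Tableaux α λ' n) → Σ (Path n α λ') λ p → toOrder p ≡ order (proj₂ (proj₂ t))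
tableau-path n t@(_ , e , mkSDT o _) =
  fromFilling n (tableau-filling n t) (trans (sym (↭-length (filling-↭ (tableau-filling n t)))) e)

path-tableau : ∀ {α λ' n} → Path n α λ' → Tableaux α λ' n
path-tableau p = ⊆ᵇ⁺ (IsFilling.incl f) , trans (↭-length (filling-↭ f)) (length-toOrder p)
               , mkSDT (toOrder p) (IsFilling⇒isSDT f)
  where f = path-filling p

Tableaux-≡ : ∀ n {α λ'} {t u : Tableaux α λ' n} → order (proj₂ (proj₂ t)) ≡ order (proj₂ (proj₂ u)) → t ≡ u
Tableaux-≡ n {t = t , e , mkSDT o v} {u = t' , e' , mkSDT .o v'} refl =
  cong₂ _,_ (T-irrelevant t t') (cong₂ _,_ (uip e e') (cong (mkSDT o) (T-irrelevant v v')))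

path-weight : (Domino → Mono) → ∀ {n α λ'} → Path n α λ' → Mono
path-weight w []      = 1ᴹ
path-weight w (s ∷ p) = w (dom s) · path-weight w p

Paths : (Domino → Mono) → ℕ → Partition → Partition → WSet
Paths w n α λ' = record { Obj = Path n α λ' ; wt = path-weight w }

evenCells : (Cell → ℕ) → List Cell → ℕ
evenCells coord = count (λ c → isEven (coord c))

evenCells-∷∷ : ∀ coord d o → evenCells coord (first d ∷ second d ∷ o) ≡ evens coord d + evenCells coord o
evenCells-∷∷ coord d o = trans (count-∷ p (first d) (second d ∷ o))
  (trans (cong (_+_ (if p (first d) then 1 else 0)) (count-∷ p (second d) o))
         (sym (+-assoc (if p (first d) then 1 else 0) _ _)))
  where p = λ c → isEven (coord c)

≡ᵇ-refl : ∀ n → (n ≡ᵇ n) ≡ true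
≡ᵇ-refl zero    = refl
≡ᵇ-refl (suc n) = ≡ᵇ-refl n

n≢ᵇ1+n : ∀ n → (n ≡ᵇ suc n) ≡ false
n≢ᵇ1+n zero    = refl
n≢ᵇ1+n (suc n) = n≢ᵇ1+n n

vertDominoes-∷∷ : ∀ d o → vertDominoes (first d ∷ second d ∷ o) ≡ verticals (Domino.orient d) + vertDominoes o
vertDominoes-∷∷ (domino hor a b) o rewrite n≢ᵇ1+n b = refl
vertDominoes-∷∷ (domino ver a b) o rewrite ≡ᵇ-refl a = refl

rise fall : ℕ → ℕ → ℤ
rise n e = + n ℤ.- + e
fall n e = ℤ.- (+ n) ℤ.+ + e

rise-+ : ∀ m n d e → rise m d ℤ.+ rise n e ≡ rise (m + n) (d + e)
rise-+ m n d e = lemma (+ m) (+ n) (+ d) (+ e)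
  where
  lemma : ∀ m n d e → (m ℤ.- d) ℤ.+ (n ℤ.- e) ≡ (m ℤ.+ n) ℤ.- (d ℤ.+ e)
  lemma = ℤ-Solver.solve-∀

fall-+ : ∀ m n d e → fall m d ℤ.+ fall n e ≡ fall (m + n) (d + e)
fall-+ m n d e = lemma (+ m) (+ n) (+ d) (+ e)
  where
  lemma : ∀ m n d e → (ℤ.- m ℤ.+ d) ℤ.+ (ℤ.- n ℤ.+ e) ≡ ℤ.- (m ℤ.+ n) ℤ.+ (d ℤ.+ e)
  lemma = ℤ-Solver.solve-∀

path-weight-order : ∀ (h : ℕ → ℕ → ℤ) → h 0 0 ≡ + 0 → (∀ m n d e → h m d ℤ.+ h n e ≡ h (m + n) (d + e)) →
  ∀ {n α λ'} (p : Path n α λ') →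
  path-weight (λ d → h 1 (evens proj₁ d) , h 1 (evens proj₂ d) , verticals (Domino.orient d)) p ≡
  (h n (evenCells proj₁ (toOrder p)) , h n (evenCells proj₂ (toOrder p)) , vertDominoes (toOrder p))
path-weight-order h h0 h+ [] = ,-≡³ (sym h0) (sym h0) refl
path-weight-order h h0 h+ {suc n} (s ∷ p) =
  trans (cong (_·_ (h 1 (evens proj₁ d) , h 1 (evens proj₂ d) , verticals (Domino.orient d))) (path-weight-order h h0 h+ p)) (,-≡³ (part proj₁) (part proj₂) (sym (vertDominoes-∷∷ d (toOrder p))))
  where
  d = dom s
  part : ∀ coord → h 1 (evens coord d) ℤ.+ h n (evenCells coord (toOrder p)) ≡
         h (suc n) (evenCells coord (first d ∷ second d ∷ toOrder p))
  part coord = trans (h+ 1 n (evens coord d) (evenCells coord (toOrder p)))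
                     (cong (h (suc n)) (sym (evenCells-∷∷ coord d (toOrder p))))

tableaux≅paths : ∀ (h : ℕ → ℕ → ℤ) → h 0 0 ≡ + 0 → (∀ m n d e → h m d ℤ.+ h n e ≡ h (m + n) (d + e)) → ∀ n α λ' →
  record { Obj = Tableaux α λ' n
         ; wt  = λ t → h n (vEven λ' α) , h n (hEven λ' α) , vertDominoes (order (proj₂ (proj₂ t))) } ≅
  Paths (λ d → h 1 (evens proj₁ d) , h 1 (evens proj₂ d) , verticals (Domino.orient d)) n α λ'
tableaux≅paths h h0 h+ n α λ' = record
  { to      = proj₁ ∘ tableau-path n
  ; from    = path-tableau
  ; to-from = λ p → toOrder-injective _ p (proj₂ (tableau-path n (path-tableau p)))
  ; from-to = λ t → Tableaux-≡ n (proj₂ (tableau-path n t))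
  ; wt-to   = weight }
  where
  weight : ∀ t → path-weight _ (proj₁ (tableau-path n t)) ≡
    (h n (vEven λ' α) , h n (hEven λ' α) , vertDominoes (order (proj₂ (proj₂ t))))
  weight t = trans (path-weight-order h h0 h+ (proj₁ (tableau-path n t)))
    (trans (cong (λ o → h n (evenCells proj₁ o) , h n (evenCells proj₂ o) , vertDominoes o) (proj₂ (tableau-path n t)))
           (,-≡³ (cong (h n) (sym (count-↭ _ rearranged))) (cong (h n) (sym (count-↭ _ rearranged))) refl))
    where rearranged = filling-↭ (tableau-filling n t)

Vector Kernel : Set₁
Vector = Partition → WSet
Kernel = Partition → Vector

apply : Kernel → Vector → Vector
apply K v α = ΣW Partition λ β → K α β ⊗ v β

G H : ℕ → Vector
G zero    α = 𝟙
G (suc n) = apply U (G n)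
H zero    α = 𝟙
H (suc n) = apply D (H n)

apply-cong : ∀ {K v v'} → (∀ α → v α ≅ v' α) → ∀ α → apply K v α ≅ apply K v' α
apply-cong {K} f α = ΣW-cong λ β → ⊗-cong (≅-refl {K α β}) (f β)

Paths⁺≅G : ∀ n α → ΣW Partition (Paths w⁺ n α) ≅ G n α
Paths⁺≅G zero α = record
  { to = λ _ → tt ; from = λ _ → α , [] ; to-from = λ _ → refl
  ; from-to = λ { (_ , []) → refl } ; wt-to = λ { (_ , []) → refl } }
Paths⁺≅G (suc n) α = ≅-trans cons (apply-cong {U} (Paths⁺≅G n) α)
  where
  cons : ΣW Partition (Paths w⁺ (suc n) α) ≅ apply U (λ β → ΣW Partition (Paths w⁺ n β)) α
  cons = record
    { to      = λ { (λ' , s ∷ p) → _ , s , λ' , p }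
    ; from    = λ (_ , s , λ' , p) → λ' , s ∷ p
    ; to-from = λ _ → refl
    ; from-to = λ { (_ , _ ∷ _) → refl }
    ; wt-to   = λ { (_ , _ ∷ _) → refl } }

_∷ʳ_ : ∀ {n μ β α} → Path n μ β → Step β α → Path (suc n) μ α
[]      ∷ʳ t = t ∷ []
(s ∷ p) ∷ʳ t = s ∷ (p ∷ʳ t)

unsnoc : ∀ {n μ α} → Path (suc n) μ α → Σ Partition λ β → Step β α × Path n μ β
unsnoc (s ∷ [])         = _ , s , []
unsnoc (s ∷ p@(_ ∷ _)) with β , t , q ← unsnoc p = β , t , s ∷ q

unsnoc-∷ʳ : ∀ {n μ β α} (p : Path n μ β) (t : Step β α) → unsnoc (p ∷ʳ t) ≡ (β , t , p)
unsnoc-∷ʳ []                t = refl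
unsnoc-∷ʳ (s ∷ [])          t = refl
unsnoc-∷ʳ (s ∷ p@(_ ∷ _)) t rewrite unsnoc-∷ʳ p t = refl

∷ʳ-unsnoc : ∀ {n μ α} (p : Path (suc n) μ α) → proj₂ (proj₂ (unsnoc p)) ∷ʳ proj₁ (proj₂ (unsnoc p)) ≡ p
∷ʳ-unsnoc (s ∷ [])        = refl
∷ʳ-unsnoc (s ∷ p@(_ ∷ _)) = cong (s ∷_) (∷ʳ-unsnoc p)

path-weight-∷ʳ : ∀ w {n μ β α} (p : Path n μ β) (t : Step β α) → path-weight w (p ∷ʳ t) ≡ w (dom t) · path-weight w p
path-weight-∷ʳ w []      t = refl
path-weight-∷ʳ w (s ∷ p) t = trans (cong (w (dom s) ·_) (path-weight-∷ʳ w p t)) (·-swapˡ (w (dom s)) (w (dom t)) (path-weight w p))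

-- Here `α` is the large end of the path, so the removal that `H` performs first is the last step of
-- the path; hence the splitting at the back.
Paths⁻≅H : ∀ n α → ΣW Partition (λ μ → Paths w⁻ n μ α) ≅ H n α
Paths⁻≅H zero α = record
  { to = λ _ → tt ; from = λ _ → α , [] ; to-from = λ _ → refl
  ; from-to = λ { (_ , []) → refl } ; wt-to = λ { (_ , []) → refl } }
Paths⁻≅H (suc n) α = ≅-trans (≅-sym snoc) (apply-cong {D} (Paths⁻≅H n) α)
  where
  snoc : apply D (λ β → ΣW Partition (λ μ → Paths w⁻ n μ β)) α ≅ ΣW Partition (λ μ → Paths w⁻ (suc n) μ α)
  snoc = record
    { to      = λ (_ , t , μ , p) → μ , p ∷ʳ t
    ; from    = λ (μ , p) → let β , t , q = unsnoc p in β , t , μ , q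
    ; to-from = λ (μ , p) → cong (μ ,_) (∷ʳ-unsnoc p)
    ; from-to = λ (_ , t , μ , p) → cong (λ (β , t , q) → β , t , μ , q) (unsnoc-∷ʳ p t)
    ; wt-to   = λ (_ , t , μ , p) → path-weight-∷ʳ w⁻ p t }

W⁺≅G : ∀ α n → W⁺ α n ≅ G n α
W⁺≅G α n = ≅-trans
  (≅-trans (record { to = id ; from = id ; to-from = λ _ → refl ; from-to = λ _ → refl ; wt-to = λ _ → refl })
           (ΣW-cong (tableaux≅paths rise refl rise-+ n α)))
  (Paths⁺≅G n α)

W⁻≅H : ∀ α n → W⁻ α n ≅ H n α
W⁻≅H α n = ≅-trans
  (≅-trans (record { to = id ; from = id ; to-from = λ _ → refl ; from-to = λ _ → refl ; wt-to = λ _ → refl })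
           (ΣW-cong (λ μ → tableaux≅paths fall refl fall-+ n μ α)))
  (Paths⁻≅H n α)

-- The 2-core

skew-pair : ∀ {α β x y} → skewCells α β ≡ x ∷ y ∷ [] → T (β ⊆ᵇ α) → T (adjacent x y) → Step β α
skew-pair {α} {β} {x} {y} e β⊆α adj = step-of (adjacent⇒domino (proj₁ (inside x∈)) (proj₁ (inside y∈)) adj)
  where
  inside : ∀ {c} → c ∈ x ∷ y ∷ [] → α ∋ c × ¬ β ∋ c
  inside p = ∈-skewCells⁻ {α} {β} (subst (_ ∈_) (sym e) p)
  x∈ : x ∈ x ∷ y ∷ []
  x∈ = here refl
  y∈ : y ∈ x ∷ y ∷ []
  y∈ = there (here refl)
  step-with : ∀ {d} → (∀ {c} → c ∈ᵈ d → c ∈ x ∷ y ∷ []) → (∀ {c} → c ∈ x ∷ y ∷ [] → c ∈ᵈ d) → IsStep β α d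
  step-with f g = record
    { new  = proj₂ ∘ inside ∘ f
    ; old  = proj₁ ∘ inside ∘ f
    ; incl = ⊆ᵇ⁻ β⊆α
    ; excl = λ {c} p ¬q → keep p ¬q (β ∋? c) }
    where
    keep : ∀ {c} → α ∋ c → ¬ c ∈ᵈ _ → Dec (β ∋ c) → β ∋ c
    keep p ¬q (yes r) = r
    keep p ¬q (no ¬r) = ⊥-elim (¬q (g (subst (_ ∈_) e (∈-skewCells⁺ p ¬r))))
  step-of : (∃ λ d → (first d ≡ x × second d ≡ y) ⊎ (first d ≡ y × second d ≡ x)) → Step β α
  step-of (d , inj₁ (refl , refl)) = mkStep d (step-with
    (λ { (inj₁ refl) → x∈ ; (inj₂ refl) → y∈ })
    (λ { (here e) → inj₁ e ; (there (here e)) → inj₂ e }))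
  step-of (d , inj₂ (refl , refl)) = mkStep d (step-with
    (λ { (inj₁ refl) → y∈ ; (inj₂ refl) → x∈ })
    (λ { (here e) → inj₂ e ; (there (here e)) → inj₁ e }))

removal⇒step : ∀ α β → T (isDominoRemoval α β) → Step β α
removal⇒step α β t with skewCells α β in eq
removal⇒step α β t | x ∷ y ∷ [] = skew-pair eq (proj₁ (T-∧⁻ t)) (proj₂ (T-∧⁻ {β ⊆ᵇ α} t))

adjacent-sym : ∀ d → T (adjacent (second d) (first d))
adjacent-sym (domino hor a b) = Equivalence.from T-∨ (inj₁ (T-∧⁺ {a ≡ᵇ a} (≡⇒≡ᵇ a a refl) (Equivalence.from (T-∨ {suc (suc b) ≡ᵇ b}) (inj₂ (≡⇒≡ᵇ b b refl)))))
adjacent-sym (domino ver a b) = Equivalence.from (T-∨ {(suc b ≡ᵇ b) ∧ _}) (inj₂ (T-∧⁺ {a ≡ᵇ a} (≡⇒≡ᵇ a a refl) (Equivalence.from (T-∨ {suc (suc b) ≡ᵇ b}) (inj₂ (≡⇒≡ᵇ b b refl)))))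

-- The two skew cells are those of the domino, but in whichever order `skewCells` lists them;
-- adjacency is therefore needed both ways round.
step⇒removal : ∀ α β → Step β α → T (isDominoRemoval α β)
step⇒removal α β s = go (skewCells α β) refl
  where
  d = dom s
  f = path-filling (s ∷ [])
  go : ∀ cs → skewCells α β ≡ cs → T (isDominoRemoval α β)
  go cs e with skewCells α β in eq | ↭-length (filling-↭ f) | skewCells-Unique α β
                | (λ {c} (p : c ∈ skewCells α β) → IsFilling.complete f (proj₁ (∈-skewCells⁻ {α} {β} p)) (proj₂ (∈-skewCells⁻ {α} {β} p)))
  ... | x ∷ y ∷ [] | refl | (x≢y ∷ _) ∷ _ | h = T-∧⁺ (⊆ᵇ⁺ (IsFilling.incl f)) (adj (h (here refl)) (h (there (here refl))))
    where
    adj : x ∈ first d ∷ second d ∷ [] → y ∈ first d ∷ second d ∷ [] → T (adjacent x y)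
    adj (here refl)         (here refl)         = ⊥-elim (x≢y refl)
    adj (here refl)         (there (here refl)) = adjacent-domino d
    adj (there (here refl)) (here refl)         = adjacent-sym d
    adj (there (here refl)) (there (here refl)) = ⊥-elim (x≢y refl)

removals⇒descent : ∀ {α γ} → Removals α γ → ∃ λ k → Descent k α γ
removals⇒descent done = 0 , []
removals⇒descent (step {α} {β} t r) with k , p ← removals⇒descent r = suc k , removal⇒step α β t ∷ p

descent⇒path : ∀ {k α γ} → Descent k α γ → Path k γ α
descent⇒path []      = []
descent⇒path (s ∷ p) = descent⇒path p ∷ʳ s

H⇒descent : ∀ j {α} → Obj (H j α) → ∃ λ μ → Descent j α μ
H⇒descent zero    _           = _ , []
H⇒descent (suc j) (_ , s , h) with μ , p ← H⇒descent j h = μ , s ∷ p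

-- An object of `H j α` contains a chain of `j` removals, to which `descent-bound` applies with the
-- chain leading to the 2-core.
H-bound : ∀ {α γ k} → IsTwoCore α γ → skewSize α γ ≡ 2 * k → ∀ j → Obj (H j α) → j ≤ k
H-bound {α} {γ} {k} (r , term) e j h with l , p ← removals⇒descent r =
  ≤-trans (descent-bound (λ δ s → term δ (step⇒removal γ δ s)) p (proj₂ (H⇒descent j h)))
          -- `Removals` does not record its length `l`; counting cells gives `2 * l = 2 * k`.
          (≤-reflexive (*-cancelˡ-≡ l k 2 (trans (sym (proj₁ (proj₂ (path-tableau (descent⇒path p))))) e)))

-- Colored involutions

ColPerm : ℕ → Set
ColPerm n = Vec (Fin n × Bool) n

IsInvolution : ∀ {n} → ColPerm n → Set
IsInvolution π = ∀ i {k b} → lookup π i ≡ (k , b) → lookup π k ≡ (i , b)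

==ᶠ⇒≡ : ∀ {n} (i j : Fin n) → T (i ==ᶠ j) → i ≡ j
==ᶠ⇒≡ i j t = toℕ-injective (≡ᵇ⇒≡ (toℕ i) (toℕ j) t)

≡⇒==ᶠ : ∀ {n} {i j : Fin n} → i ≡ j → T (i ==ᶠ j)
≡⇒==ᶠ {i = i} refl = ≡⇒≡ᵇ (toℕ i) (toℕ i) refl

T⇒≡true : ∀ {b} → T b → b ≡ true
T⇒≡true = Equivalence.to T-≡

¬T⇒≡false : ∀ {b} → ¬ T b → b ≡ false
¬T⇒≡false {true}  ¬t = ⊥-elim (¬t tt)
¬T⇒≡false {false} ¬t = refl

sign : Bool → ℤ
sign b = if b then ℤ.- (+ 1) else + 1

entryAt : ∀ {n} → Fin n × Bool → Fin n → ℤ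
entryAt (k' , b) k = if k' ==ᶠ k then sign b else + 0

entry≡entryAt : ∀ {n} (π : ColPerm n) i k → entry π i k ≡ entryAt (lookup π i) k
entry≡entryAt π i k with lookup π i
... | _ , _ = refl

entryAt-hit : ∀ {n} (k : Fin n) b → entryAt (k , b) k ≡ sign b
entryAt-hit k b rewrite T⇒≡true (≡⇒==ᶠ {i = k} refl) = refl

entryAt-miss : ∀ {n} (x : Fin n × Bool) {k} → proj₁ x ≢ k → entryAt x k ≡ + 0
entryAt-miss (k' , b) {k} ne rewrite ¬T⇒≡false (ne ∘ ==ᶠ⇒≡ k' k) = refl

sign-injective : ∀ b c → sign b ≡ sign c → b ≡ c
sign-injective false false _ = refl
sign-injective true  true  _ = refl

sign≢0 : ∀ b → sign b ≢ + 0
sign≢0 true  ()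
sign≢0 false ()

entryAt≡sign : ∀ {n} (x : Fin n × Bool) i b → entryAt x i ≡ sign b → x ≡ (i , b)
entryAt≡sign (k , c) i b e with k Fin.≟ i
... | yes refl = cong (k ,_) (sign-injective c b (trans (sym (entryAt-hit k c)) e))
... | no ne    = ⊥-elim (sign≢0 b (trans (sym e) (entryAt-miss (k , c) ne)))

==ᶻ⇒≡ : ∀ x y → T (x ==ᶻ y) → x ≡ y
==ᶻ⇒≡ x y t with yes e ← x ℤ.≟ y = e

≡⇒==ᶻ : ∀ x y → x ≡ y → T (x ==ᶻ y)
≡⇒==ᶻ x y e with x ℤ.≟ y
... | yes _ = tt
... | no ne = ⊥-elim (ne e)

all-Fin⁺ : ∀ {n} {p : Fin n → Bool} → (∀ i → T (p i)) → T (all p (finList n))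
all-Fin⁺ {n} {p} f = Allₚ.all⁻ p {finList n} (All.tabulate (λ {i} _ → f i))

all-Fin⁻ : ∀ {n} (p : Fin n → Bool) → T (all p (finList n)) → ∀ i → T (p i)
all-Fin⁻ {n} p t i = All.lookup (Allₚ.all⁺ p (finList n) t) (∈-allFin i)

-- By symmetry row `k` of the matrix has the same nonzero entry in column `i` as row `i` has in
-- column `k`. Its column is the value and its sign the bar, so it determines `lookup π k`.
valid⇒involution : ∀ {n} (π : ColPerm n) → T (isPerm π ∧ isSymmetric π) → IsInvolution π
valid⇒involution π t i {k} {b} e = entryAt≡sign (lookup π k) i b
  (trans (sym (entry≡entryAt π k i)) (trans (sym symmetric)
    (trans (entry≡entryAt π i k) (trans (cong (λ x → entryAt x k) e) (entryAt-hit k b)))))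
  where
  symmetric : entry π i k ≡ entry π k i
  symmetric = ==ᶻ⇒≡ _ _ (all-Fin⁻ _ (all-Fin⁻ _ (proj₂ (T-∧⁻ {isPerm π} t)) i) k)

involution⇒valid : ∀ {n} (π : ColPerm n) → IsInvolution π → T (isPerm π ∧ isSymmetric π)
involution⇒valid π inv = T-∧⁺ (all-Fin⁺ λ i → all-Fin⁺ λ j → injective i j) (all-Fin⁺ λ i → all-Fin⁺ λ k → ≡⇒==ᶻ _ _
    (trans (entry≡entryAt π i k) (trans (symmetric i k) (sym (entry≡entryAt π k i)))))
  where
  partner : Fin _ → Fin _
  partner i = proj₁ (lookup π i)
  partner-involutive : ∀ i → partner (partner i) ≡ i
  partner-involutive i = cong proj₁ (inv i refl)
  injective : ∀ i j → T ((i ==ᶠ j) ∨ not (partner i ==ᶠ partner j))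
  injective i j with i Fin.≟ j
  ... | yes e = Equivalence.from T-∨ (inj₁ (≡⇒==ᶠ e))
  ... | no ne = Equivalence.from (T-∨ {i ==ᶠ j}) (inj₂ (T-not⁺ λ t → ne
    (trans (sym (partner-involutive i)) (trans (cong partner (==ᶠ⇒≡ (partner i) (partner j) t)) (partner-involutive j)))))
  symmetric : ∀ i k → entryAt (lookup π i) k ≡ entryAt (lookup π k) i
  symmetric i k with partner i Fin.≟ k
  ... | yes refl = trans (entryAt-hit (partner i) _)
    (sym (trans (cong (λ x → entryAt x i) (inv i refl)) (entryAt-hit i _)))
  ... | no ne = trans (entryAt-miss (lookup π i) ne) (sym (entryAt-miss (lookup π k)
    λ e → ne (trans (cong partner (sym e)) (partner-involutive k))))

ColInv-ext : ∀ {n} {π ρ : ColInv n} → (∀ i → lookup (perm π) i ≡ lookup (perm ρ) i) → π ≡ ρ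
ColInv-ext {π = mkColInv π v} {mkColInv ρ w} h
  with refl ← trans (sym (tabulate∘lookup π)) (trans (tabulate-cong h) (tabulate∘lookup ρ)) =
  cong (mkColInv π) (T-irrelevant v w)

involution : ∀ {n} (π : ColInv n) → IsInvolution (perm π)
involution (mkColInv π v) = valid⇒involution π v

mkInvolution : ∀ {n} (f : Fin n → Fin n × Bool) → (∀ i {k b} → f i ≡ (k , b) → f k ≡ (i , b)) →
  Σ (ColInv n) λ π → ∀ i → lookup (perm π) i ≡ f i
mkInvolution f inv = mkColInv (tabulate f) (involution⇒valid (tabulate f)
  λ i e → trans (lookup∘tabulate f _) (inv i (trans (sym (lookup∘tabulate f i)) e))) , lookup∘tabulate f

relabel : ∀ {m n} → (Fin m → Fin n) → Fin m × Bool → Fin n × Bool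
relabel e (k , b) = e k , b

module _ {m n : ℕ} (e : Fin m → Fin n) (e-injective : ∀ {i j} → e i ≡ e j → i ≡ j) where

  relabel-injective : ∀ {x y} → relabel e x ≡ relabel e y → x ≡ y
  relabel-injective {k , b} {l , c} p = cong₂ _,_ (e-injective (cong proj₁ p)) (cong proj₂ p)

  Restricts : ColInv n → ColInv m → Set
  Restricts π ρ = ∀ i → lookup (perm π) (e i) ≡ relabel e (lookup (perm ρ) i)

  -- `shape` says that the image of `e` is closed under `π`. The images used below omit exactly the
  -- cycle of the first letter.
  restrict : (π : ColInv n) → (∀ i → ∃ λ x → lookup (perm π) (e i) ≡ relabel e x) → Σ (ColInv m) (Restricts π)
  restrict π shape = proj₁ made , λ i → trans (proj₂ (shape i)) (cong (relabel e) (sym (proj₂ made i)))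
    where
    made : Σ (ColInv m) λ ρ → ∀ i → lookup (perm ρ) i ≡ proj₁ (shape i)
    made = mkInvolution (proj₁ ∘ shape) λ i {k} {b} p → relabel-injective
      (trans (sym (proj₂ (shape k))) (involution π (e i) (trans (proj₂ (shape i)) (cong (relabel e) p))))

  Restricts-functional : ∀ {π ρ ρ'} → Restricts π ρ → Restricts π ρ' → ρ ≡ ρ'
  Restricts-functional r r' = ColInv-ext λ i → relabel-injective (trans (sym (r i)) (r' i))

data PunchView {n} (j : Fin (suc n)) : Fin (suc n) → Set where
  at  : PunchView j j
  off : ∀ i → PunchView j (punchIn j i)

punchView : ∀ {n} (j i : Fin (suc n)) → PunchView j i
punchView j i with j Fin.≟ i
... | yes refl = at
... | no j≢i   = subst (PunchView j) (punchIn-punchOut j≢i) (off (punchOut j≢i))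

-- The dictionary between dominoes and cycles: horizontal is unbarred, vertical is barred. A barred
-- 2-cycle has two barred values, whence q and not q^(1/2).
colour : Orientation → Bool
colour hor = false
colour ver = true

orientation : ∀ b → ∃ λ o → colour o ≡ b
orientation false = hor , refl
orientation true  = ver , refl

colour-injective : ∀ {o o'} → colour o ≡ colour o' → o ≡ o'
colour-injective {hor} {hor} _ = refl
colour-injective {ver} {ver} _ = refl

skip : ∀ {n} → Fin (suc n) → Fin n → Fin (suc (suc n))
skip j i = Fin.suc (punchIn j i)

Fin-suc-injective : ∀ {n} {i j : Fin n} → Fin.suc i ≡ Fin.suc j → i ≡ j
Fin-suc-injective refl = refl

skip-injective : ∀ {n} (j : Fin (suc n)) {i i'} → skip j i ≡ skip j i' → i ≡ i'
skip-injective j {i} {i'} p = punchIn-injective j i i' (Fin-suc-injective p)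

Fixed : ∀ {n} → ColInv (suc n) → Orientation → ColInv n → Set
Fixed π o ρ = lookup (perm π) Fin.zero ≡ (Fin.zero , colour o) × Restricts Fin.suc Fin-suc-injective π ρ

Paired : ∀ n → ColInv (suc n) → Fin n → Orientation → ColInv (pred n) → Set
Paired (suc n) π j o ρ = lookup (perm π) Fin.zero ≡ (Fin.suc j , colour o) × Restricts (skip j) (skip-injective j) π ρ

-- A 1-cycle leaves `n` letters; a 2-cycle leaves `n - 1`, with `n` choices of the partner. At
-- `n = 0` the value `pred 0` does no harm, as `scale 0` is empty.
data Reduces {n} (π : ColInv (suc n)) : Obj ((𝕔 ⊗ CI n) ⊕ scale n (𝕖 ⊗ CI (pred n))) → Set where
  fixed  : ∀ {o ρ}   → Fixed π o ρ      → Reduces π (inj₁ (o , ρ))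
  paired : ∀ {j o ρ} → Paired n π j o ρ → Reduces π (inj₂ (j , o , ρ))

removeFixed : ∀ {n} (π : ColInv (suc n)) b → lookup (perm π) Fin.zero ≡ (Fin.zero , b) → Σ _ (Reduces π)
removeFixed π b e =
  inj₁ (proj₁ (orientation b) , proj₁ rest) ,
  fixed (trans e (cong (_ ,_) (sym (proj₂ (orientation b)))) , proj₂ rest)
  where
  shape : ∀ i x → lookup (perm π) (Fin.suc i) ≡ x → ∃ λ y → lookup (perm π) (Fin.suc i) ≡ relabel Fin.suc y
  shape i (Fin.zero  , c) p with () ← trans (sym e) (involution π (Fin.suc i) p)
  shape i (Fin.suc k , c) p = (k , c) , p
  rest = restrict Fin.suc Fin-suc-injective π (λ i → shape i _ refl)

removePaired : ∀ {n} (π : ColInv (suc n)) (j : Fin n) b → lookup (perm π) Fin.zero ≡ (Fin.suc j , b) → Σ _ (Reduces π)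
removePaired {suc n} π j b e =
  inj₂ (j , proj₁ (orientation b) , proj₁ rest) ,
  paired (trans e (cong (_ ,_) (sym (proj₂ (orientation b)))) , proj₂ rest)
  where
  shape : ∀ i x → lookup (perm π) (skip j i) ≡ x → ∃ λ y → lookup (perm π) (skip j i) ≡ relabel (skip j) y
  shape i (Fin.zero  , c) p =
    ⊥-elim (punchInᵢ≢i j i (sym (Fin-suc-injective (cong proj₁ (trans (sym e) (involution π (skip j i) p))))))
  shape i (Fin.suc k , c) p with punchView j k
  ... | at    with () ← trans (sym (involution π Fin.zero e)) (involution π (skip j i) p)
  ... | off l = (l , c) , p
  rest = restrict (skip j) (skip-injective j) π (λ i → shape i _ refl)

removeZero : ∀ {n} (π : ColInv (suc n)) → Σ _ (Reduces π)
removeZero π with lookup (perm π) Fin.zero in e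
... | Fin.zero  , b = removeFixed π b e
... | Fin.suc j , b = removePaired π j b e

insertZero : ∀ {n} y → Σ (ColInv (suc n)) λ π → Reduces π y
insertZero {n} (inj₁ (o , ρ)) = proj₁ made , fixed (proj₂ made Fin.zero , λ i → proj₂ made (Fin.suc i))
  where
  f : Fin (suc n) → Fin (suc n) × Bool
  f Fin.zero    = Fin.zero , colour o
  f (Fin.suc i) = relabel Fin.suc (lookup (perm ρ) i)
  f-involutive : ∀ i {k b} → f i ≡ (k , b) → f k ≡ (i , b)
  f-involutive Fin.zero    refl = refl
  f-involutive (Fin.suc i) refl = cong (relabel Fin.suc) (involution ρ i refl)
  made = mkInvolution f f-involutive
insertZero {suc n} (inj₂ (j , o , ρ)) = proj₁ made , paired (proj₂ made Fin.zero , λ i → trans (proj₂ made (skip j i)) (f-skip i))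
  where
  g : ∀ {i} → PunchView j i → Fin (suc (suc n)) × Bool
  g at      = Fin.zero , colour o
  g (off i) = relabel (skip j) (lookup (perm ρ) i)
  f : Fin (suc (suc n)) → Fin (suc (suc n)) × Bool
  f Fin.zero    = Fin.suc j , colour o
  f (Fin.suc i) = g (punchView j i)
  -- `punchView j (punchIn j i)` does not reduce; independence of the chosen view replaces that
  -- computation.
  view-unique : ∀ {i} (v w : PunchView j i) → g v ≡ g w
  view-unique v w = go v w refl
    where
    go : ∀ {i i'} (v : PunchView j i) (w : PunchView j i') → i ≡ i' → g v ≡ g w
    go at      at       _ = refl
    go at      (off i)  e = ⊥-elim (punchInᵢ≢i j i (sym e))
    go (off i) at       e = ⊥-elim (punchInᵢ≢i j i e)
    go (off i) (off i') e with refl ← punchIn-injective j i i' e = refl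
  f-skip : ∀ i → f (skip j i) ≡ relabel (skip j) (lookup (perm ρ) i)
  f-skip i = view-unique (punchView j (punchIn j i)) (off i)
  f-involutive : ∀ i {k b} → f i ≡ (k , b) → f k ≡ (i , b)
  f-involutive Fin.zero    refl = view-unique (punchView j j) at
  f-involutive (Fin.suc i) e = go (punchView j i) e
    where
    go : ∀ {i} (v : PunchView j i) {k b} → g v ≡ (k , b) → f k ≡ (Fin.suc i , b)
    go at      refl = refl
    go (off i) refl = trans (f-skip _) (cong (relabel (skip j)) (involution ρ i refl))
  made = mkInvolution f f-involutive

Reduces-functional : ∀ {n} {π : ColInv (suc n)} {y y'} → Reduces π y → Reduces π y' → y ≡ y'
Reduces-functional {π = π} (fixed {ρ = ρ} (e , r)) (fixed {ρ = ρ'} (e' , r')) = cong inj₁ (cong₂ _,_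
  (colour-injective (cong proj₂ (trans (sym e) e')))
  (Restricts-functional Fin.suc Fin-suc-injective {π} {ρ} {ρ'} r r'))
Reduces-functional {suc n} (fixed (e , r)) (paired (e' , r')) with () ← trans (sym e) e'
Reduces-functional {suc n} (paired (e , r)) (fixed (e' , r')) with () ← trans (sym e) e'
Reduces-functional {suc n} {π} (paired {j} {ρ = ρ} (e , r)) (paired {ρ = ρ'} (e' , r'))
  with refl ← Fin-suc-injective (cong proj₁ (trans (sym e) e')) = cong (λ z → inj₂ (j , z)) (cong₂ _,_
  (colour-injective (cong proj₂ (trans (sym e) e')))
  (Restricts-functional (skip j) (skip-injective j) {π} {ρ} {ρ'} r r'))

Reduces-injective : ∀ {n} {π π' : ColInv (suc n)} {y} → Reduces π y → Reduces π' y → π ≡ π'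
Reduces-injective (fixed (e , r)) (fixed (e' , r')) =
  ColInv-ext λ { Fin.zero → trans e (sym e') ; (Fin.suc i) → trans (r i) (sym (r' i)) }
Reduces-injective {suc n} {π} {π'} (paired {j} (e , r)) (paired (e' , r')) =
  ColInv-ext λ { Fin.zero → trans e (sym e') ; (Fin.suc i) → go (punchView j i) }
  where
  go : ∀ {i} → PunchView j i → lookup (perm π) (Fin.suc i) ≡ lookup (perm π') (Fin.suc i)
  go at      = trans (involution π Fin.zero e) (sym (involution π' Fin.zero e'))
  go (off i) = trans (r i) (sym (r' i))

-- Weights under removal of a cycle

bit : Bool → ℕ
bit b = if b then 1 else 0

countFin : ∀ {n} → (Fin n → Bool) → ℕ
countFin {zero}  p = 0
countFin {suc n} p = bit (p Fin.zero) + countFin (p ∘ Fin.suc)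

count-tabulate : ∀ {A : Set} (p : A → Bool) {n} (f : Fin n → A) → count p (List.tabulate f) ≡ countFin (p ∘ f)
count-tabulate p {zero}  f = refl
count-tabulate p {suc n} f = trans (count-∷ p (f Fin.zero) (List.tabulate (f ∘ Fin.suc))) (cong (_+_ (bit (p (f Fin.zero)))) (count-tabulate p (f ∘ Fin.suc)))

countFin-cong : ∀ {n} {p q : Fin n → Bool} → (∀ i → p i ≡ q i) → countFin p ≡ countFin q
countFin-cong {zero}  h = refl
countFin-cong {suc n} h = cong₂ _+_ (cong bit (h Fin.zero)) (countFin-cong (h ∘ Fin.suc))

countFin-punchIn : ∀ {n} (p : Fin (suc n) → Bool) j → countFin p ≡ bit (p j) + countFin (p ∘ punchIn j)
countFin-punchIn         p Fin.zero    = refl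
countFin-punchIn {suc n} p (Fin.suc j) =
  trans (cong (_+_ (bit (p Fin.zero))) (countFin-punchIn (p ∘ Fin.suc) j))
    (+-CSProperties.x∙yz≈y∙xz (bit (p Fin.zero)) (bit (p (Fin.suc j))) _)

-- All three exponents count letters by whether they are fixed and whether they are barred, so the
-- removal of a cycle is analysed once for every such `P`.
statistic : (Bool → Bool → Bool) → ∀ {n} → ColInv n → ℕ
statistic P π = countFin λ i → P (proj₁ (lookup (perm π) i) ==ᶠ i) (proj₂ (lookup (perm π) i))

module _ (P : Bool → Bool → Bool) where

  statistic-fixed : ∀ {n} {π : ColInv (suc n)} {o ρ} → Fixed π o ρ →
    statistic P π ≡ bit (P true (colour o)) + statistic P ρ
  statistic-fixed (e , r) = cong₂ _+_
    (cong (λ x → bit (P (proj₁ x ==ᶠ Fin.zero) (proj₂ x))) e)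
    (countFin-cong λ i → cong (λ x → P (proj₁ x ==ᶠ Fin.suc i) (proj₂ x)) (r i))

  statistic-paired : ∀ {n} {π : ColInv (suc (suc n))} {j o ρ} → Paired (suc n) π j o ρ →
    statistic P π ≡ bit (P false (colour o)) + (bit (P false (colour o)) + statistic P ρ)
  statistic-paired {n} {π} {j} {o} {ρ} (e , r) = cong₂ _+_
    (cong (λ x → bit (P (proj₁ x ==ᶠ Fin.zero) (proj₂ x))) e)
    (trans (countFin-punchIn {n} (λ i → P (proj₁ (lookup (perm π) (Fin.suc i)) ==ᶠ Fin.suc i) (proj₂ (lookup (perm π) (Fin.suc i)))) j) (cong₂ _+_
      (cong (λ x → bit (P (proj₁ x ==ᶠ Fin.suc j) (proj₂ x))) (involution π Fin.zero e))
      (countFin-cong λ i → trans (cong (λ x → P (proj₁ x ==ᶠ skip j i) (proj₂ x)) (r i))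
        (cong (λ b → P b (proj₂ (lookup (perm ρ) i))) (skip-==ᶠ _ i)))))
    where
    skip-==ᶠ : ∀ k i → (skip j k ==ᶠ skip j i) ≡ (k ==ᶠ i)
    skip-==ᶠ k i with k Fin.≟ i
    ... | yes refl = trans (T⇒≡true (≡⇒==ᶠ {i = skip j k} refl)) (sym (T⇒≡true (≡⇒==ᶠ {i = k} refl)))
    ... | no ne    = trans (¬T⇒≡false (ne ∘ skip-injective j ∘ ==ᶠ⇒≡ (skip j k) (skip j i))) (sym (¬T⇒≡false (ne ∘ ==ᶠ⇒≡ k i)))

unbarredFixed barredFixed barred : Bool → Bool → Bool
unbarredFixed s b = s ∧ not b
barredFixed   s b = s ∧ b
barred        s b = b

CI-weight : ∀ {n} (π : ColInv n) → wt (CI n) π ≡ (+ statistic unbarredFixed π , + statistic barredFixed π , statistic barred π)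
CI-weight π = ,-≡³ (cong +_ (count-statistic unbarredFixed)) (cong +_ (count-statistic barredFixed)) (count-statistic barred)
  where
  count-statistic : ∀ P → count (λ i → P (proj₁ (lookup (perm π) i) ==ᶠ i) (proj₂ (lookup (perm π) i))) (finList _) ≡ statistic P π
  count-statistic P = count-tabulate (λ i → P (proj₁ (lookup (perm π) i) ==ᶠ i) (proj₂ (lookup (perm π) i))) id

CI-suc : ∀ n → CI (suc n) ≅ (𝕔 ⊗ CI n) ⊕ scale n (𝕖 ⊗ CI (pred n))
CI-suc n = fromRelation Reduces removeZero insertZero Reduces-functional Reduces-injective weight
  where
  weight : ∀ {n} {π : ColInv (suc n)} {y} → Reduces π y → wt ((𝕔 ⊗ CI n) ⊕ scale n (𝕖 ⊗ CI (pred n))) y ≡ wt (CI (suc n)) π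
  weight {π = π} (fixed {o} {ρ} r) = trans (cong (wt 𝕔 o ·_) (CI-weight ρ)) (trans (shift o)
    (trans (sym (,-≡³ (cong +_ (statistic-fixed unbarredFixed {π = π} {o} {ρ} r)) (cong +_ (statistic-fixed barredFixed {π = π} {o} {ρ} r)) (statistic-fixed barred {π = π} {o} {ρ} r))) (sym (CI-weight π))))
    where
    shift : ∀ o {a b c} → wt 𝕔 o · (+ a , + b , c) ≡
      (+ (bit (unbarredFixed true (colour o)) + a) , + (bit (barredFixed true (colour o)) + b) , bit (colour o) + c)
    shift hor = refl
    shift ver = refl
  weight {suc n} {π} (paired {j} {o} {ρ} r) = trans (cong (wt 𝕖 o ·_) (CI-weight ρ)) (trans (shift o)
    (trans (sym (,-≡³ (cong +_ (statistic-paired unbarredFixed {π = π} {j} {o} {ρ} r)) (cong +_ (statistic-paired barredFixed {π = π} {j} {o} {ρ} r)) (statistic-paired barred {π = π} {j} {o} {ρ} r))) (sym (CI-weight π))))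
    where
    shift : ∀ o {a b c} → wt 𝕖 o · (+ a , + b , c) ≡
      (+ a , + b , bit (colour o) + (bit (colour o) + c))
    shift hor = refl
    shift ver = refl

CI-0 : CI 0 ≅ 𝟙
CI-0 = record
  { to = λ _ → tt ; from = λ _ → mkColInv Vec.[] tt ; to-from = λ _ → refl
  ; from-to = λ { (mkColInv Vec.[] tt) → refl } ; wt-to = λ { (mkColInv Vec.[] tt) → refl } }

-- The recurrence

⊗-congʳ : ∀ A {B B'} → B ≅ B' → A ⊗ B ≅ A ⊗ B'
⊗-congʳ A f = ⊗-cong (≅-refl {A}) f

scale-congʳ : ∀ n {A B} → A ≅ B → scale n A ≅ scale n B
scale-congʳ n = scale-cong {n} refl

apply-⊕ : ∀ K {v v'} α → apply K (λ β → v β ⊕ v' β) α ≅ apply K v α ⊕ apply K v' α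
apply-⊕ K α = ≅-trans (ΣW-cong λ β → ⊗-distribˡ-⊕ {K α β}) ΣW-⊕

apply-⊗ : ∀ K A v α → apply K (λ β → A ⊗ v β) α ≅ A ⊗ apply K v α
apply-⊗ K A v α = record
  { to      = λ (β , s , a , x) → a , β , s , x
  ; from    = λ (a , β , s , x) → β , s , a , x
  ; to-from = λ _ → refl
  ; from-to = λ _ → refl
  ; wt-to   = λ (β , s , a , x) → ·-swapˡ (wt A a) (wt (K α β) s) (wt (v β) x) }

apply-ΣW : ∀ K {I} {v : I → Vector} α → apply K (λ β → ΣW I (λ i → v i β)) α ≅ ΣW I (λ i → apply K (v i) α)
apply-ΣW K α = record
  { to      = λ (β , s , i , x) → i , β , s , x
  ; from    = λ (i , β , s , x) → β , s , i , x
  ; to-from = λ _ → refl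
  ; from-to = λ _ → refl
  ; wt-to   = λ _ → refl }

-- The identity between kernels passes to functions because composition is associative and the sum
-- against `Id` collapses to the term at `α`.
apply-UD : ∀ v α → apply U (apply D v) α ≅ apply D (apply U v) α ⊕ (𝕖 ⊗ v α)
apply-UD v α =
  apply U (apply D v) α
    ≅⟨ regroup U D ⟩
  ΣW Partition (λ γ → ΣW Partition (λ β → U α β ⊗ D β γ) ⊗ v γ)
    ≅⟨ ΣW-cong (λ γ → ⊗-cong (UD≅DU α γ) ≅-refl) ⟩
  ΣW Partition (λ γ → (ΣW Partition (λ β → D α β ⊗ U β γ) ⊕ (Id α γ ⊗ 𝕖)) ⊗ v γ)
    ≅⟨ diagonal (λ γ → ΣW Partition (λ β → D α β ⊗ U β γ)) ⟩
  ΣW Partition (λ γ → ΣW Partition (λ β → D α β ⊗ U β γ) ⊗ v γ) ⊕ (𝕖 ⊗ v α)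
    ≅⟨ ⊕-cong (regroup D U) ≅-refl ⟨
  apply D (apply U v) α ⊕ (𝕖 ⊗ v α) ∎
  where
  open ≅-Reasoning
  regroup : ∀ K L → apply K (apply L v) α ≅ ΣW Partition (λ γ → ΣW Partition (λ β → K α β ⊗ L β γ) ⊗ v γ)
  regroup K L = record
    { to      = λ (β , s , γ , t , x) → γ , (β , s , t) , x
    ; from    = λ (γ , (β , s , t) , x) → β , s , γ , t , x
    ; to-from = λ _ → refl
    ; from-to = λ _ → refl
    ; wt-to   = λ (β , s , γ , t , x) → ·-assoc (wt (K α β) s) (wt (L β γ) t) (wt (v γ) x) }
  diagonal : ∀ (M : Vector) → ΣW Partition (λ γ → (M γ ⊕ (Id α γ ⊗ 𝕖)) ⊗ v γ) ≅ ΣW Partition (λ γ → M γ ⊗ v γ) ⊕ (𝕖 ⊗ v α)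
  diagonal M = record
    { to      = λ { (γ , inj₁ m , x) → inj₁ (γ , m , x) ; (_ , inj₂ (refl , o) , x) → inj₂ (o , x) }
    ; from    = λ { (inj₁ (γ , m , x)) → γ , inj₁ m , x ; (inj₂ (o , x)) → α , inj₂ (refl , o) , x }
    ; to-from = λ { (inj₁ _) → refl ; (inj₂ _) → refl }
    ; from-to = λ { (_ , inj₁ _ , _) → refl ; (_ , inj₂ (refl , _) , _) → refl }
    ; wt-to   = λ { (_ , inj₁ _ , _) → refl
                  ; (_ , inj₂ (refl , o) , x) → cong (_· wt (v α) x) (sym (·-identityˡ (wt 𝕖 o))) } }

⊗-identityʳ : ∀ A → A ⊗ 𝟙 ≅ A
⊗-identityʳ A = record
  { to = proj₁ ; from = _, tt ; to-from = λ _ → refl ; from-to = λ _ → refl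
  ; wt-to = λ (a , _) → sym (·-identityʳ (wt A a)) }

apply-U-𝟙 : ∀ α → apply U (λ _ → 𝟙) α ≅ apply D (λ _ → 𝟙) α ⊕ (𝕔 ⊗ 𝟙)
apply-U-𝟙 α = ≅-trans (ΣW-cong λ β → ⊗-identityʳ (U α β))
  (≅-trans (additions≅removals α) (≅-sym (⊕-cong (ΣW-cong λ β → ⊗-identityʳ (D α β)) (⊗-identityʳ 𝕔))))

-- Induction by applying U to the recurrence. Moving U past D yields one new copy of `𝕖 ⊗ G n α`,
-- while the `n` copies of `𝕖 ⊗ G (pred n)` become copies of `𝕖 ⊗ G n`; together these are `n + 1`.
G-suc : ∀ n α → G (suc n) α ≅ apply D (G n) α ⊕ ((𝕔 ⊗ G n α) ⊕ scale n (𝕖 ⊗ G (pred n) α))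
G-suc zero α = ≅-trans (apply-U-𝟙 α) (⊕-cong ≅-refl (⊕-empty λ ()))
G-suc (suc n) α =
  apply U (G (suc n)) α
    ≅⟨ apply-cong {U} (G-suc n) α ⟩
  apply U (λ β → apply D (G n) β ⊕ ((𝕔 ⊗ G n β) ⊕ E n β)) α
    ≅⟨ ≅-trans (apply-⊕ U α) (⊕-cong (apply-UD (G n) α) (≅-trans (apply-⊕ U α)
       (⊕-cong (apply-⊗ U 𝕔 (G n) α) (apply-E n)))) ⟩
  (apply D (G (suc n)) α ⊕ (𝕖 ⊗ G n α)) ⊕ ((𝕔 ⊗ G (suc n) α) ⊕ scale n (𝕖 ⊗ G n α))
    ≅⟨ ≅-trans ⊕-assoc (⊕-cong ≅-refl (≅-trans ⊕-swapˡ (⊕-cong ≅-refl (≅-sym scale-suc)))) ⟩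
  apply D (G (suc n)) α ⊕ ((𝕔 ⊗ G (suc n) α) ⊕ scale (suc n) (𝕖 ⊗ G n α)) ∎
  where
  open ≅-Reasoning
  E : ℕ → Vector
  E n β = scale n (𝕖 ⊗ G (pred n) β)
  apply-E : ∀ n → apply U (E n) α ≅ scale n (𝕖 ⊗ G n α)
  -- U applied to `G (pred 0)` is not `G 0`, but both sides have zero copies.
  apply-E zero    = record { to = λ { (_ , _ , () , _) } ; from = λ { (() , _) }
    ; to-from = λ { (() , _) } ; from-to = λ { (_ , _ , () , _) } ; wt-to = λ { (_ , _ , () , _) } }
  apply-E (suc n) = ≅-trans (apply-ΣW U α) (scale-congʳ (suc n) (apply-⊗ U 𝕖 (G n) α))

-- The sum runs over all `j` because D evaluates `F n` at other partitions, for which the bound `k`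
-- is different. For `j > n` the coefficient is 0, so the truncated difference `n ∸ j` does no harm.
F : ℕ → Vector
F n α = ΣW ℕ λ j → scale (n C j) (H j α ⊗ CI (n ∸ j))

nC0≡1 : ∀ n → n C 0 ≡ 1
nC0≡1 n = trans (nCk≡nC[n∸k] {0} {n} z≤n) (nCn≡1 n)

-- Both sides count the `j`-subsets of `n + 1` letters together with a letter outside. This trades
-- the factor `n - j` that `CI-suc` produces on `n - j + 1` letters for the factor `n` of the
-- recurrence.
absorption : ∀ n j → j ≤ suc n → (suc n C j) * (suc n ∸ j) ≡ suc n * (n C j)
absorption n zero _ rewrite nC0≡1 (suc n) | nC0≡1 n = trans (*-identityˡ (suc n)) (sym (*-identityʳ (suc n)))
absorption zero (suc zero) _ = refl
absorption zero (suc (suc j)) (s≤s ())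
absorption (suc n) (suc j) (s≤s j≤n) = begin
  (suc (suc n) C suc j) * (suc n ∸ j)
    ≡⟨ cong (_* (suc n ∸ j)) (sym (nCk+nC[k+1]≡[n+1]C[k+1] (suc n) j)) ⟩
  (suc n C j + suc n C suc j) * (suc n ∸ j)
    ≡⟨ *-distribʳ-+ (suc n ∸ j) (suc n C j) (suc n C suc j) ⟩
  (suc n C j) * (suc n ∸ j) + (suc n C suc j) * (suc n ∸ j)
    ≡⟨ cong₂ _+_ (absorption n j j≤n) (last j≤n) ⟩
  suc n * (n C j) + (suc n * (n C suc j) + (suc n C suc j))
    ≡⟨ sym (+-assoc (suc n * (n C j)) (suc n * (n C suc j)) (suc n C suc j)) ⟩
  suc n * (n C j) + suc n * (n C suc j) + (suc n C suc j)
    ≡⟨ cong (_+ (suc n C suc j)) (sym (*-distribˡ-+ (suc n) (n C j) (n C suc j))) ⟩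
  suc n * (n C j + n C suc j) + (suc n C suc j)
    ≡⟨ cong (λ x → suc n * x + (suc n C suc j)) (nCk+nC[k+1]≡[n+1]C[k+1] n j) ⟩
  suc n * (suc n C suc j) + (suc n C suc j)
    ≡⟨ +-comm (suc n * (suc n C suc j)) (suc n C suc j) ⟩
  suc (suc n) * (suc n C suc j) ∎
  where
  open ≡-Reasoning
  last : j ≤ suc n → (suc n C suc j) * (suc n ∸ j) ≡ suc n * (n C suc j) + (suc n C suc j)
  last j≤1+n with m≤n⇒m<n∨m≡n j≤1+n
  ... | inj₁ (s≤s j≤n) = begin
    (suc n C suc j) * (suc n ∸ j)                     ≡⟨ cong ((suc n C suc j) *_) (+-∸-assoc 1 j≤n) ⟩
    (suc n C suc j) * suc (n ∸ j)                     ≡⟨ *-suc (suc n C suc j) (n ∸ j) ⟩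
    (suc n C suc j) + (suc n C suc j) * (n ∸ j)       ≡⟨ +-comm (suc n C suc j) _ ⟩
    (suc n C suc j) * (n ∸ j) + (suc n C suc j)       ≡⟨ cong (_+ (suc n C suc j)) (absorption n (suc j) (s≤s j≤n)) ⟩
    suc n * (n C suc j) + (suc n C suc j) ∎
  -- At `j = n + 1` the binomials with lower index `n + 2` vanish, and with them both sides.
  ... | inj₂ refl rewrite n∸n≡0 n | k>n⇒nCk≡0 {n} {suc (suc n)} (s≤s (n≤1+n n)) | k>n⇒nCk≡0 {suc n} {suc (suc n)} ≤-refl =
    sym (trans (+-identityʳ _) (*-zeroʳ n))

absorption-pred : ∀ n j → j ≤ n → (n C j) * (n ∸ j) ≡ n * (pred n C j)
absorption-pred zero    zero j≤n = refl
absorption-pred (suc n) j    j≤n = absorption n j j≤n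

⊗-scale : ∀ {A n B} → A ⊗ scale n B ≅ scale n (A ⊗ B)
⊗-scale = record
  { to      = λ (a , i , b) → i , a , b
  ; from    = λ (i , a , b) → a , i , b
  ; to-from = λ _ → refl ; from-to = λ _ → refl ; wt-to = λ _ → refl }

⊗-swapˡ : ∀ {A B X} → A ⊗ (B ⊗ X) ≅ B ⊗ (A ⊗ X)
⊗-swapˡ {A} {B} {X} = record
  { to      = λ (a , b , x) → b , a , x
  ; from    = λ (b , a , x) → a , b , x
  ; to-from = λ _ → refl ; from-to = λ _ → refl
  ; wt-to   = λ (a , b , x) → ·-swapˡ (wt B b) (wt A a) (wt X x) }

⊗-ΣW : ∀ {A I} {B : I → WSet} → A ⊗ ΣW I B ≅ ΣW I (λ i → A ⊗ B i)
⊗-ΣW = record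
  { to      = λ (a , i , b) → i , a , b
  ; from    = λ (i , a , b) → a , i , b
  ; to-from = λ _ → refl ; from-to = λ _ → refl ; wt-to = λ _ → refl }

scale-ΣW : ∀ {n I} {B : I → WSet} → scale n (ΣW I B) ≅ ΣW I (λ i → scale n (B i))
scale-ΣW = record
  { to      = λ (k , i , b) → i , k , b
  ; from    = λ (i , k , b) → k , i , b
  ; to-from = λ _ → refl ; from-to = λ _ → refl ; wt-to = λ _ → refl }

empty≅ : ∀ {A B} → ¬ Obj A → ¬ Obj B → A ≅ B
empty≅ ¬a ¬b = record
  { to      = λ a → ⊥-elim (¬a a) ; from    = λ b → ⊥-elim (¬b b)
  ; to-from = λ b → ⊥-elim (¬b b) ; from-to = λ a → ⊥-elim (¬a a)
  ; wt-to   = λ a → ⊥-elim (¬a a) }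

scale-0 : ∀ n A → n ≡ 0 → ¬ Obj (scale n A)
scale-0 _ A refl (() , _)

module _ (α : Partition) where
  open ≅-Reasoning

  private
    D-F : ∀ n → ΣW ℕ (λ j → scale (n C j) (H (suc j) α ⊗ CI (n ∸ j))) ≅ apply D (F n) α
    D-F n = ≅-sym (≅-trans (apply-ΣW D α) (ΣW-cong λ j → ≅-trans (apply-ΣW D α) (ΣW-cong λ _ → record
      { to      = λ (β , s , h , π) → (β , s , h) , π
      ; from    = λ ((β , s , h) , π) → β , s , h , π
      ; to-from = λ _ → refl ; from-to = λ _ → refl
      ; wt-to   = λ (β , s , h , π) → ·-assoc (wt (D α β) s) (wt (H j β) h) (wt (CI (n ∸ j)) π) })))

    -- Of the two summands for index `j + 1`, the one with `n C j` has a leading D in `H (suc j)`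
    -- and contributes to D `F n`. The other ones, joined with the term of index 0, again form a sum
    -- over all `j`, now with one letter more.
    pascal : ∀ n → F (suc n) α ≅ apply D (F n) α ⊕ ΣW ℕ (λ j → scale (n C j) (H j α ⊗ CI (suc n ∸ j)))
    pascal n =
      F (suc n) α
        ≅⟨ ΣW-ℕ ⟩
      scale (suc n C 0) (H 0 α ⊗ CI (suc n)) ⊕ ΣW ℕ (λ j → scale (suc n C suc j) (H (suc j) α ⊗ CI (n ∸ j)))
        ≅⟨ ⊕-cong (scale-cong (trans (nC0≡1 (suc n)) (sym (nC0≡1 n))) ≅-refl)
             (≅-trans (ΣW-cong (λ j → ≅-trans (scale-cong (sym (nCk+nC[k+1]≡[n+1]C[k+1] n j)) ≅-refl) (scale-+ {n C j}))) ΣW-⊕) ⟩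
      scale (n C 0) (H 0 α ⊗ CI (suc n)) ⊕ (ΣW ℕ (λ j → scale (n C j) (H (suc j) α ⊗ CI (n ∸ j))) ⊕
        ΣW ℕ (λ j → scale (n C suc j) (H (suc j) α ⊗ CI (n ∸ j))))
        ≅⟨ ≅-trans ⊕-swapˡ (⊕-cong (D-F n) (≅-sym ΣW-ℕ)) ⟩
      apply D (F n) α ⊕ ΣW ℕ (λ j → scale (n C j) (H j α ⊗ CI (suc n ∸ j))) ∎

    -- Removes the cycle of the first of `n + 1 - j` letters. When `j > n` the numbers of letters
    -- are truncated and no longer fit, but all three binomials are 0.
    term : ∀ n j → scale (n C j) (H j α ⊗ CI (suc n ∸ j)) ≅
      (𝕔 ⊗ scale (n C j) (H j α ⊗ CI (n ∸ j))) ⊕ scale n (𝕖 ⊗ scale (pred n C j) (H j α ⊗ CI (pred n ∸ j)))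
    term n j with j ≤? n
    ... | no j≰n = ≅-trans (empty≅ (scale-0 _ X nCj≡0) (λ (_ , x) → scale-0 _ Y nCj≡0 x))
                     (⊕-empty (λ (_ , _ , x) → scale-0 _ Z (k>n⇒nCk≡0 (≤-<-trans (pred[n]≤n {n}) (≰⇒> j≰n))) x))
      where
      X = H j α ⊗ CI (suc n ∸ j)
      Y = H j α ⊗ CI (n ∸ j)
      Z = H j α ⊗ CI (pred n ∸ j)
      nCj≡0 : n C j ≡ 0
      nCj≡0 = k>n⇒nCk≡0 (≰⇒> j≰n)
    ... | yes j≤n =
      scale (n C j) (H j α ⊗ CI (suc n ∸ j))
        ≅⟨ scale-congʳ (n C j) (⊗-congʳ (H j α) (≅-trans (CI-cong (+-∸-assoc 1 j≤n)) (CI-suc (n ∸ j)))) ⟩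
      scale (n C j) (H j α ⊗ ((𝕔 ⊗ CI (n ∸ j)) ⊕ scale (n ∸ j) (𝕖 ⊗ CI (pred (n ∸ j)))))
        ≅⟨ scale-congʳ (n C j) (⊗-distribˡ-⊕ {H j α}) ⟩
      scale (n C j) ((H j α ⊗ (𝕔 ⊗ CI (n ∸ j))) ⊕ (H j α ⊗ scale (n ∸ j) (𝕖 ⊗ CI (pred (n ∸ j)))))
        ≅⟨ scale-⊕ {n C j} ⟩
      scale (n C j) (H j α ⊗ (𝕔 ⊗ CI (n ∸ j))) ⊕ scale (n C j) (H j α ⊗ scale (n ∸ j) (𝕖 ⊗ CI (pred (n ∸ j))))
        ≅⟨ ⊕-cong pull-𝕔 pull-𝕖 ⟩
      (𝕔 ⊗ scale (n C j) (H j α ⊗ CI (n ∸ j))) ⊕ scale n (𝕖 ⊗ scale (pred n C j) (H j α ⊗ CI (pred n ∸ j))) ∎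
      where
      CI-cong : ∀ {m n} → m ≡ n → CI m ≅ CI n
      CI-cong refl = ≅-refl
      pred-∸ : ∀ n j → pred (n ∸ j) ≡ pred n ∸ j
      pred-∸ zero    zero    = refl
      pred-∸ zero    (suc j) = refl
      pred-∸ (suc n) j       = pred[m∸n]≡m∸[1+n] (suc n) j
      pull-𝕔 : scale (n C j) (H j α ⊗ (𝕔 ⊗ CI (n ∸ j))) ≅ 𝕔 ⊗ scale (n C j) (H j α ⊗ CI (n ∸ j))
      pull-𝕔 = ≅-trans (scale-congʳ (n C j) (⊗-swapˡ {H j α} {𝕔} {CI (n ∸ j)})) (≅-sym (⊗-scale {𝕔} {n C j}))
      pull-𝕖 : scale (n C j) (H j α ⊗ scale (n ∸ j) (𝕖 ⊗ CI (pred (n ∸ j)))) ≅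
               scale n (𝕖 ⊗ scale (pred n C j) (H j α ⊗ CI (pred n ∸ j)))
      pull-𝕖 =
        scale (n C j) (H j α ⊗ scale (n ∸ j) (𝕖 ⊗ CI (pred (n ∸ j))))
          ≅⟨ scale-congʳ (n C j) (≅-trans (⊗-scale {H j α} {n ∸ j}) (scale-congʳ (n ∸ j) (⊗-swapˡ {H j α} {𝕖} {CI (pred (n ∸ j))}))) ⟩
        scale (n C j) (scale (n ∸ j) (𝕖 ⊗ (H j α ⊗ CI (pred (n ∸ j)))))
          ≅⟨ scale-* {n C j} ⟨
        scale ((n C j) * (n ∸ j)) (𝕖 ⊗ (H j α ⊗ CI (pred (n ∸ j))))
          ≅⟨ scale-cong (absorption-pred n j j≤n) (⊗-congʳ 𝕖 (⊗-congʳ (H j α) (CI-cong (pred-∸ n j)))) ⟩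
        scale (n * (pred n C j)) (𝕖 ⊗ (H j α ⊗ CI (pred n ∸ j)))
          ≅⟨ scale-* {n} ⟩
        scale n (scale (pred n C j) (𝕖 ⊗ (H j α ⊗ CI (pred n ∸ j))))
          ≅⟨ scale-congʳ n (⊗-scale {𝕖} {pred n C j}) ⟨
        scale n (𝕖 ⊗ scale (pred n C j) (H j α ⊗ CI (pred n ∸ j))) ∎

  F-suc : ∀ n → F (suc n) α ≅ apply D (F n) α ⊕ ((𝕔 ⊗ F n α) ⊕ scale n (𝕖 ⊗ F (pred n) α))
  F-suc n = ≅-trans (pascal n) (⊕-cong ≅-refl (≅-trans (ΣW-cong (term n))
    (≅-trans ΣW-⊕ (⊕-cong (≅-sym (⊗-ΣW {𝕔}))
      (≅-sym (≅-trans (scale-cong {n} refl (⊗-ΣW {𝕖})) (scale-ΣW {n})))))))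

  F-0 : F 0 α ≅ 𝟙
  F-0 = ≅-trans ΣW-ℕ (≅-trans (≅-sym (⊕-empty λ { (_ , () , _) }))
    (≅-trans scale-1 (≅-trans (⊗-congʳ 𝟙 CI-0) (⊗-identityʳ 𝟙))))

-- The recurrence is of second order and D looks at other partitions, so the induction carries two
-- consecutive indices and all partitions at once.
recurrence-unique : ∀ n α → G n α ≅ F n α
recurrence-unique n = proj₁ (both n)
  where
  both : ∀ n → (∀ α → G n α ≅ F n α) × (∀ α → G (pred n) α ≅ F (pred n) α)
  both zero    = (λ α → ≅-sym (F-0 α)) , (λ α → ≅-sym (F-0 α))
  both (suc n) with now , before ← both n = (λ α → ≅-trans (G-suc n α) (≅-trans
    (⊕-cong (apply-cong {D} now α) (⊕-cong (⊗-congʳ 𝕔 (now α)) (scale-congʳ n (⊗-congʳ 𝕖 (before α)))))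
    (≅-sym (F-suc α n)))) , now

theorem3p11 : (α α̃ : Partition) (k : ℕ) → IsTwoCore α α̃ → skewSize α α̃ ≡ 2 * k →
    (n : ℕ) → W⁺ α n ≋ sumTo k (λ j → scale (n C j) (W⁻ α j ⊗ CI (n ∸ j)))
theorem3p11 α α̃ k core e n = ≅⇒≋ (
  W⁺ α n                                                 ≅⟨ W⁺≅G α n ⟩
  G n α                                                  ≅⟨ recurrence-unique n α ⟩
  F n α                                                  ≅⟨ ΣW-truncate k (λ j (_ , h , _) → H-bound core e j h) ⟩
  sumTo k (λ j → scale (n C j) (H j α ⊗ CI (n ∸ j)))     ≅⟨ ΣW-cong (λ j → scale-cong refl (⊗-cong (≅-sym (W⁻≅H α (toℕ j))) ≅-refl)) ⟩
  sumTo k (λ j → scale (n C j) (W⁻ α j ⊗ CI (n ∸ j)))    ∎)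
  where open ≅-Reasoning
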